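{- Let $3\leq g<n$ and let $G$ be a unicyclic graph on $n$ vertices with girth $g$. Then $F(G)\leq F(U_{n,g}^p)$, with equality if and only if $G$ is isomorphic to $U_{n,g}^p$. Moreover, $$F(U_{n,g}^p)=n+g^2-g+1+(2^{n-g}-1)\left(2g+\binom{g-1}{2}\right).$$
   Context: All graphs are finite, simple and undirected. A unicyclic graph is a connected graph with the same number of vertices and edges; its girth is the length of its unique cycle. The pineapple graph $U_{n,g}^p$ ($3\leq g<n$) is obtained from the cycle $C_g$ by attaching $n-g$ new pendant vertices to a single vertex of the cycle. A connected subgraph of a graph $G=(V,E)$ is a graph $(V',E')$ with $\emptyset\neq V'\subseteq V$, $E'\subseteq E$, every edge of $E'$ having both endpoints in $V'$, and $(V',E')$ connected; distinct pairs $(V',E')$ are counted separately. The core index $F(G)$ is the number of connected subgraphs of $G$. -}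

module Defs where

open import Data.Nat using (ℕ; zero; suc; _+_; _*_; _∸_; _^_; _≤_; _<_; _≡ᵇ_; _<ᵇ_)
open import Data.Bool using (Bool; true; false; _∧_; _∨_; not; if_then_else_; T)
open import Data.Fin using (Fin; zero; suc; toℕ; inject₁; fromℕ)
open import Data.Fin.Properties using (_≟_)
open import Data.Vec using (Vec; []; _∷_; lookup; replicate; tabulate; updateAt)
open import Data.List using (List; []; _∷_; _++_; map; length; filter; concatMap; zip; foldr; allFin)
open import Data.List.Relation.Unary.Any using (Any)
open import Data.Empty using (⊥)
open import Data.Product using (_×_; _,_; Σ; ∃)
open import Relation.Binary.PropositionalEquality using (_≡_)
open import Relation.Nullary using (¬_; does)
open import Function.Bundles using (_↔_; Inverse)
open import Function.Definitions using (Injective)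

Graph : ℕ → Set
Graph n = Fin n → Fin n → Bool

Simple : {n : ℕ} → Graph n → Set
Simple {n} G = (∀ (i j : Fin n) → G i j ≡ G j i) × (∀ (i : Fin n) → G i i ≡ false)

edges : {n : ℕ} → Graph n → List (Fin n × Fin n)
edges {n} G =
  concatMap (λ i → map (λ j → (i , j))
                       (filter (λ j → Data.Bool._≟_ ((toℕ i <ᵇ toℕ j) ∧ G i j) true) (allFin n)))
            (allFin n)

data Reach {n : ℕ} (G : Graph n) : Fin n → Fin n → Set where
  here : ∀ {i} → Reach G i i
  step : ∀ {i j k} → G i j ≡ true → Reach G j k → Reach G i k

Connected : {n : ℕ} → Graph n → Set
Connected {n} G = ∀ (i j : Fin n) → Reach G i j

HasCycleOfLength : {n : ℕ} → Graph n → ℕ → Set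
HasCycleOfLength {n} G zero = ⊥
HasCycleOfLength {n} G (suc zero) = ⊥
HasCycleOfLength {n} G (suc (suc zero)) = ⊥
HasCycleOfLength {n} G (suc (suc (suc m))) =
  Σ (Fin (suc (suc (suc m))) → Fin n) λ f →
    Injective _≡_ _≡_ f
    × (∀ (i : Fin (suc (suc m))) → G (f (inject₁ i)) (f (suc i)) ≡ true)
    × G (f (fromℕ (suc (suc m)))) (f zero) ≡ true

HasGirth : {n : ℕ} → Graph n → ℕ → Set
HasGirth G g = HasCycleOfLength G g × (∀ k → k < g → ¬ HasCycleOfLength G k)

Unicyclic : {n : ℕ} → Graph n → Set
Unicyclic {n} G = Connected G × length (edges G) ≡ n

_≅_ : {n : ℕ} → Graph n → Graph n → Set
_≅_ {n} G H = Σ (Fin n ↔ Fin n) λ σ →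
  ∀ (i j : Fin n) → G i j ≡ H (Inverse.to σ i) (Inverse.to σ j)

-- Pineapple graph U^p_{n,g}: vertices 0..g-1 form the cycle
-- 0 ~ 1 ~ ... ~ g-1 ~ 0, and each vertex g..n-1 is a pendant vertex
-- attached to vertex 0.

pineAdj₀ : ℕ → ℕ → ℕ → Bool
pineAdj₀ g a b =
     ((b ≡ᵇ suc a) ∧ (b <ᵇ g))
  ∨ ((a ≡ᵇ 0) ∧ (suc b ≡ᵇ g))
  ∨ ((a ≡ᵇ 0) ∧ not (b <ᵇ g))

pineapple : (n g : ℕ) → Graph n
pineapple n g i j =
  not (toℕ i ≡ᵇ toℕ j) ∧ (pineAdj₀ g (toℕ i) (toℕ j) ∨ pineAdj₀ g (toℕ j) (toℕ i))

-- Core index F(G): number of pairs (V', E') with V' ⊆ V nonempty,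
-- E' ⊆ E(G), every edge of E' having both endpoints in V', and (V', E')
-- connected.

allVecs : (k : ℕ) → List (Vec Bool k)
allVecs zero = [] ∷ []
allVecs (suc k) = map (true ∷_) (allVecs k) ++ map (false ∷_) (allVecs k)

allBoolLists : ℕ → List (List Bool)
allBoolLists zero = [] ∷ []
allBoolLists (suc k) = map (true ∷_) (allBoolLists k) ++ map (false ∷_) (allBoolLists k)

select : {A : Set} → List A → List Bool → List A
select (x ∷ xs) (true ∷ bs) = x ∷ select xs bs
select (x ∷ xs) (false ∷ bs) = select xs bs
select _ _ = []

anyFin : {n : ℕ} → (Fin n → Bool) → Bool
anyFin {n} p = foldr (λ i b → p i ∨ b) false (allFin n)

allFin? : {n : ℕ} → (Fin n → Bool) → Bool
allFin? {n} p = foldr (λ i b → p i ∧ b) true (allFin n)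

allList : {A : Set} → (A → Bool) → List A → Bool
allList p = foldr (λ x b → p x ∧ b) true

anyList : {A : Set} → (A → Bool) → List A → Bool
anyList p = foldr (λ x b → p x ∨ b) false

eqFin : {n : ℕ} → Fin n → Fin n → Bool
eqFin i j = does (i ≟ j)

expand : {n : ℕ} → List (Fin n × Fin n) → Vec Bool n → Vec Bool n
expand E' R = tabulate λ y →
  lookup R y ∨ anyList (λ { (a , b) → (eqFin b y ∧ lookup R a) ∨ (eqFin a y ∧ lookup R b) }) E'

iterate : {A : Set} → ℕ → (A → A) → A → A
iterate zero f x = x
iterate (suc k) f x = f (iterate k f x)

-- vertices reachable from v via edges of E' (n iterations suffice)
reachFrom : {n : ℕ} → List (Fin n × Fin n) → Fin n → Vec Bool n
reachFrom {n} E' v = iterate n (expand E') (tabulate (eqFin v))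

-- (V', E') is a connected (nonempty) subgraph: every edge of E' has both
-- endpoints in V', V' is nonempty, and for some (equivalently every)
-- vertex v ∈ V' every vertex of V' is reachable from v along E'.
isConnectedSub : {n : ℕ} → Vec Bool n → List (Fin n × Fin n) → Bool
isConnectedSub V' E' =
  allList (λ { (a , b) → lookup V' a ∧ lookup V' b }) E'
  ∧ anyFin (λ v → lookup V' v ∧ allFin? (λ w → not (lookup V' w) ∨ lookup (reachFrom E' v) w))

count : {A : Set} → (A → Bool) → List A → ℕ
count p xs = length (filter (λ x → Data.Bool._≟_ (p x) true) xs)

F : {n : ℕ} → Graph n → ℕ
F {n} G =
  foldr _+_ 0
    (map (λ V' → count (λ mask → isConnectedSub V' (select (edges G) mask))
                        (allBoolLists (length (edges G))))
         (allVecs n))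

{-# OPTIONS --safe #-}
module Submission where

open import Defs
open import Algebra.Properties.CommutativeSemigroup using (interchange)
open import Data.Bool using (Bool; true; false; if_then_else_; T; _∧_; _∨_; not)
import Data.Bool as Bool
open import Data.Bool.Properties using (∨-comm; ⇔→≡)
open import Data.Fin using (Fin; zero; suc; toℕ; inject₁; fromℕ)
open import Data.Fin.Properties using (any?; toℕ-injective; toℕ<n) renaming (_≟_ to _≟ᶠ_; suc-injective to sucᶠ-injective)
open import Data.Fin.Subset using (Subset; ∣_∣) renaming (_∈_ to _∈ₛ_)
open import Data.Fin.Subset.Properties using (∣p∣≤n; p⊂q⇒∣p∣<∣q∣; ⊆-antisym)
open import Data.List as List using (List; []; _∷_; _++_; _∷ʳ_; map; length; filter; foldr; allFin; tabulate; take; drop)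
open import Data.List.Membership.DecPropositional using (_∈?_)
open import Data.List.Membership.Propositional using (_∈_; _∉_)
open import Data.List.Membership.Propositional.Properties using (∈-allFin; ∈-++⁻; ∈-++⁺ˡ; ∈-++⁺ʳ; ∈-∃++; ∈-map⁺; ∈-map⁻; ∈-concatMap⁺; ∈-concatMap⁻; ∈-filter⁺; ∈-filter⁻; ∈-tabulate⁺; ∈-tabulate⁻)
open import Data.List.Properties using (length-++; filter-++; ++-assoc; map-++; map-∘; map-tabulate; length-map; length-tabulate; length-take; length-drop; take-map; drop-map; take++drop≡id; tabulate-lookup; ∷-injective)
open import Data.List.Relation.Binary.Permutation.Homogeneous as Homogeneous using (Permutation; prep; swap)
import Data.List.Relation.Binary.Permutation.Setoid as PermSetoid
import Data.List.Relation.Binary.Permutation.Setoid.Properties as PermSetoidProperties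
open import Data.List.Relation.Binary.Pointwise using ([]; _∷_)
open import Data.List.Relation.Unary.All as All using (All; []; _∷_; all?)
open import Data.List.Relation.Unary.All.Properties using (¬Any⇒All¬) renaming (map⁺ to All-map⁺)
open import Data.List.Relation.Unary.AllPairs as AllPairs using ([]; _∷_)
import Data.List.Relation.Unary.AllPairs.Properties as AllPairs
open import Data.List.Relation.Unary.Any as Any using (here; there)
open import Data.List.Relation.Unary.Unique.Propositional using (Unique)
open import Data.List.Relation.Unary.Unique.Propositional.Properties using (allFin⁺; concat⁺; filter⁺) renaming (map⁺ to Unique-map⁺; tabulate⁺ to Unique-tabulate⁺)
import Data.List.Relation.Unary.Unique.Setoid as UniqueSetoid
open import Data.Nat using (ℕ; zero; suc; _+_; _*_; _∸_; _^_; _⊓_; _≤_; _<_; z≤n; s≤s; _<ᵇ_; _≡ᵇ_)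
open import Data.Nat.Combinatorics using (_C_; nC1≡n; nCk+nC[k+1]≡[n+1]C[k+1])
open import Data.Nat.Properties
open import Data.Nat.Tactic.RingSolver using (solve-∀)
open import Data.Product as Product using (_×_; _,_; Σ; ∃; ∃₂; proj₁; proj₂)
open import Data.Sum using (_⊎_; inj₁; inj₂; [_,_]′)
open import Data.Unit using (tt)
open import Data.Vec as Vec using (Vec; []; _∷_; lookup)
open import Data.Vec.Properties using (tabulate-cong; lookup∘tabulate; lookup⇒[]=; []=⇒lookup)
open import Function.Base using (_∘_; id)
open import Function.Bundles using (_⇔_; mk⇔; mk↔ₛ′; Inverse)
open import Function.Definitions using (Injective)
open import Level using (0ℓ)
open import Relation.Binary using (Setoid; Rel; Reflexive; Symmetric; tri<; tri≈; tri>)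
open import Relation.Binary.Construct.Closure.ReflexiveTransitive using (Star; ε; _◅_; _◅◅_; reverse; kleisliStar)
open import Relation.Binary.PropositionalEquality
open import Relation.Nullary using (¬_; Dec; yes; no; does; contradiction)
open import Relation.Nullary.Decidable using (does-⇔; dec-false; dec-true; _×-dec_; ¬?)

-- Since G is connected and contains a cycle of length g, it can be rebuilt from that cycle by
-- adding one new vertex and one edge at a time; this uses up all n edges, so G is the cycle with
-- leaves attached successively.  Let N u be the number of connected subgraphs containing u.
-- Attaching a leaf v at p adds 1 + N p to the core index, and changes N u into N u plus the number
-- of connected subgraphs containing u and p, so N u at most doubles, and doubles only if p = u;
-- moreover N v = 1 + N p afterwards.  Hence N u ≤ 2^m c after m leaves, where c is the value on the
-- cycle, with equality only if u lies on the cycle and all leaves are attached at u.  Summing over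
-- the leaves gives the bound, and equality at the last leaf already forces G to be the pineapple.

-- The definition enumerates Boolean masks over the vertices and over an edge list in a fixed order,
-- whereas the argument wants to remove whichever leaf came last. So both enumerations become sums
-- over sublists, where the head of a list can be split off, and these sums depend on their lists
-- only up to order and, for edges, up to orientation. The edge list of `G` can then be replaced by
-- the one that the construction yields, whose heads are the newest leaf and its edge. The count
-- also carries a list of required vertices: none gives the core index, one gives N u, two give the
-- term that a leaf at p adds to N u, and a single recurrence covers all three. Equality is decided
-- by the one-vertex subgraph on u: it is counted by N u but misses every p different from u, so a
-- leaf placed elsewhere loses strictly. For a cycle of length g the starting values are g^2 + 1 in
-- total and c = 1 + g(g+1)/2 = 2g + C(g-1, 2) through a vertex; leaves at a hub add 1 + 2^i c for i
-- < m = n - g, hence m + (2^m - 1) c altogether.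

private
  variable
    A B : Set
    n m k : ℕ

-- Sums over sublists

sublistSum : List A → (List A → ℕ) → ℕ
sublistSum []       φ = φ []
sublistSum (x ∷ xs) φ = sublistSum xs (φ ∘ (x ∷_)) + sublistSum xs φ

-- Sublists inherit `All P`; this is how the freshness of a leaf, known for the full lists, reaches
-- every chosen vertex set and edge set.
sublistSum-cong : ∀ {P : A → Set} {xs} {φ ψ : List A → ℕ} → All P xs →
  (∀ {ys} → All P ys → φ ys ≡ ψ ys) → sublistSum xs φ ≡ sublistSum xs ψ
sublistSum-cong []         eq = eq []
sublistSum-cong (px ∷ pxs) eq =
  cong₂ _+_ (sublistSum-cong pxs (eq ∘ (px ∷_))) (sublistSum-cong pxs eq)

sublistSum-ext : ∀ (xs : List A) {φ ψ} → (∀ ys → φ ys ≡ ψ ys) → sublistSum xs φ ≡ sublistSum xs ψ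
sublistSum-ext []       eq = eq []
sublistSum-ext (x ∷ xs) eq = cong₂ _+_ (sublistSum-ext xs (eq ∘ (x ∷_))) (sublistSum-ext xs eq)

sublistSum-0 : ∀ (xs : List A) → sublistSum xs (λ _ → 0) ≡ 0
sublistSum-0 []       = refl
sublistSum-0 (x ∷ xs) = cong₂ _+_ (sublistSum-0 xs) (sublistSum-0 xs)

sublistSum-+ : ∀ (xs : List A) φ ψ →
  sublistSum xs (λ ys → φ ys + ψ ys) ≡ sublistSum xs φ + sublistSum xs ψ
sublistSum-+ []       φ ψ = refl
sublistSum-+ (x ∷ xs) φ ψ = trans
  (cong₂ _+_ (sublistSum-+ xs (φ ∘ (x ∷_)) (ψ ∘ (x ∷_))) (sublistSum-+ xs φ ψ))
  (interchange +-commutativeSemigroup (sublistSum xs (φ ∘ (x ∷_))) (sublistSum xs (ψ ∘ (x ∷_)))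
                 (sublistSum xs φ) (sublistSum xs ψ))

sublistSum-mono : ∀ (xs : List A) {φ ψ} → (∀ ys → φ ys ≤ ψ ys) → sublistSum xs φ ≤ sublistSum xs ψ
sublistSum-mono []       le = le []
sublistSum-mono (x ∷ xs) le = +-mono-≤ (sublistSum-mono xs (le ∘ (x ∷_))) (sublistSum-mono xs le)

sublistSum-mono-<-[] : ∀ (xs : List A) {φ ψ} → (∀ ys → φ ys ≤ ψ ys) → φ [] < ψ [] →
  sublistSum xs φ < sublistSum xs ψ
sublistSum-mono-<-[] []       le lt = lt
sublistSum-mono-<-[] (x ∷ xs) le lt =
  +-mono-≤-< (sublistSum-mono xs (le ∘ (x ∷_))) (sublistSum-mono-<-[] xs le lt)

-- One strict term is enough. It sits at a singleton because the later witness is a one-vertex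
-- subgraph without edges.
sublistSum-mono-< : ∀ {x : A} {xs φ ψ} → (∀ ys → φ ys ≤ ψ ys) → x ∈ xs → φ (x ∷ []) < ψ (x ∷ []) →
  sublistSum xs φ < sublistSum xs ψ
sublistSum-mono-< {xs = x ∷ xs} le (here refl) lt =
  +-mono-<-≤ (sublistSum-mono-<-[] xs (le ∘ (x ∷_)) lt) (sublistSum-mono xs le)
sublistSum-mono-< {xs = x ∷ xs} le (there p) lt =
  +-mono-≤-< (sublistSum-mono xs (le ∘ (x ∷_))) (sublistSum-mono-< le p lt)

sublistSum-map : ∀ (h : A → B) xs φ → sublistSum (map h xs) φ ≡ sublistSum xs (φ ∘ map h)
sublistSum-map h []       φ = refl
sublistSum-map h (x ∷ xs) φ =
  cong₂ _+_ (sublistSum-map h xs (φ ∘ (h x ∷_))) (sublistSum-map h xs φ)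

-- Two functions are compared, since splitting off related heads leaves different functions on the
-- two sides. Transitivity sums `ψ` over the middle list; reflexivity of the permutation relation
-- shows that `φ` and `ψ` agree on each list, which turns the hypothesis into invariance of `ψ`.
sublistSum-↭ : ∀ {R : Rel A 0ℓ} → Reflexive R → Symmetric R →
  ∀ {xs ys φ ψ} → Permutation R xs ys →
  (∀ {as bs} → Permutation R as bs → φ as ≡ ψ bs) → sublistSum xs φ ≡ sublistSum ys ψ
sublistSum-↭ rf sy (Homogeneous.refl [])       eq = eq (Homogeneous.refl [])
sublistSum-↭ rf sy (Homogeneous.refl (r ∷ rs)) eq =
  cong₂ _+_ (sublistSum-↭ rf sy (Homogeneous.refl rs) (λ p → eq (prep r p)))
            (sublistSum-↭ rf sy (Homogeneous.refl rs) eq)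
sublistSum-↭ rf sy (prep r p) eq =
  cong₂ _+_ (sublistSum-↭ rf sy p (λ q → eq (prep r q))) (sublistSum-↭ rf sy p eq)
sublistSum-↭ rf sy {x ∷ y ∷ xs} {y′ ∷ x′ ∷ ys} {φ} {ψ} (swap r s p) eq = trans
  (cong₂ _+_
    (cong₂ _+_ (sublistSum-↭ rf sy p (λ q → eq (swap r s q)))
               (sublistSum-↭ rf sy p (λ q → eq (prep r q))))
    (cong₂ _+_ (sublistSum-↭ rf sy p (λ q → eq (prep s q))) (sublistSum-↭ rf sy p eq)))
  (interchange +-commutativeSemigroup (sublistSum ys (λ zs → ψ (y′ ∷ x′ ∷ zs))) (sublistSum ys (ψ ∘ (x′ ∷_)))
                 (sublistSum ys (ψ ∘ (y′ ∷_))) (sublistSum ys ψ))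
sublistSum-↭ {R = R} rf sy {φ = φ} {ψ} (Homogeneous.trans p q) eq = trans
  (sublistSum-↭ rf sy p eq)
  (sublistSum-↭ rf sy q λ {as} r → trans (sym (eq {as} ↭.refl)) (eq r))
  where
  module ↭ = Setoid (Homogeneous.setoid {R = R} rf sy)

-- Rearrangements determined by membership

module UniqueRearrangement (S : Setoid 0ℓ 0ℓ) where
  open Setoid S using () renaming (sym to ≈-sym; trans to ≈-trans)
  open import Data.List.Membership.Setoid S using () renaming (_∈_ to _∈ˢ_)
  open import Data.List.Membership.Setoid.Properties using () renaming (∈-∃++ to ∈-∃++ˢ)
  open import Data.List.Relation.Unary.Unique.Setoid S using () renaming (Unique to Uniqueˢ)
  open import Data.List.Relation.Binary.Permutation.Setoid S using (_↭_; ↭-refl; ↭-trans; ↭-prep; ↭-reflexive-≋)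
  open import Data.List.Relation.Binary.Permutation.Setoid.Properties S using (shift; ∈-resp-↭; xs↭ys⇒|xs|≡|ys|; ++-identityʳ)

  -- Each element of `xs` is moved to the front of `ys` and removed; distinctness keeps the
  -- remaining elements available. The setoid is a parameter because vertices are compared by
  -- equality and edges up to reversal.
  unique-⊆⇒↭++ : ∀ {xs ys} → Uniqueˢ xs → (∀ {x} → x ∈ˢ xs → x ∈ˢ ys) → ∃ λ zs → ys ↭ xs ++ zs
  unique-⊆⇒↭++ {[]}     {ys} _         _   = ys , ↭-refl
  unique-⊆⇒↭++ {x ∷ xs} {ys} (x∉ ∷ uq) sub with ∈-∃++ˢ S (sub (here (Setoid.refl S)))
  ... | as , bs , w , x≈w , ys≋ = proj₁ rec ,
    ↭-trans ys↭ (↭-prep x (proj₂ rec))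
    where
    ys↭ : ys ↭ x ∷ as ++ bs
    ys↭ = ↭-trans (↭-reflexive-≋ ys≋) (shift (≈-sym x≈w) as bs)
    rest : ∀ {z} → z ∈ˢ xs → z ∈ˢ as ++ bs
    rest z∈ with ∈-resp-↭ ys↭ (sub (there z∈))
    ... | there p   = p
    ... | here z≈x = contradiction (≈-sym z≈x) (All.lookupₛ S (λ e ne x≈ → ne (≈-trans x≈ (≈-sym e))) x∉ z∈)
    rec = unique-⊆⇒↭++ uq rest

  unique-⊆⇒length≤ : ∀ {xs ys} → Uniqueˢ xs → (∀ {x} → x ∈ˢ xs → x ∈ˢ ys) → length xs ≤ length ys
  unique-⊆⇒length≤ {xs} {ys} uq sub with unique-⊆⇒↭++ uq sub
  ... | zs , ys↭ = subst (length xs ≤_) (sym (trans (xs↭ys⇒|xs|≡|ys| ys↭) (length-++ xs))) (m≤m+n _ _)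

  unique-⊆⇒↭ : ∀ {xs ys} → Uniqueˢ xs → (∀ {x} → x ∈ˢ xs → x ∈ˢ ys) → length ys ≤ length xs → ys ↭ xs
  unique-⊆⇒↭ {xs} {ys} uq sub ≤len with unique-⊆⇒↭++ uq sub
  ... | []     , ys↭ = ↭-trans ys↭ (++-identityʳ xs)
  ... | z ∷ zs , ys↭ = contradiction
    (subst (_≤ length xs) (trans (xs↭ys⇒|xs|≡|ys| ys↭) (length-++ xs)) ≤len)
    (<⇒≱ (m<m+n (length xs) (s≤s z≤n)))

-- The core index as a sum over sublists

indicator : Bool → ℕ
indicator b = if b then 1 else 0

count-++ : ∀ (p : A → Bool) xs ys → count p (xs ++ ys) ≡ count p xs + count p ys
count-++ p xs ys = trans (cong length (filter-++ (λ x → p x Bool.≟ true) xs ys)) (length-++ (filter _ xs))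

count-map : ∀ (p : B → Bool) (h : A → B) xs → count p (map h xs) ≡ count (p ∘ h) xs
count-map p h []       = refl
count-map p h (x ∷ xs) with p (h x)
... | true  = cong suc (count-map p h xs)
... | false = count-map p h xs

count-select : ∀ (p : List A → Bool) xs →
  count (λ mask → p (select xs mask)) (allBoolLists (length xs)) ≡ sublistSum xs (indicator ∘ p)
count-select p [] with p []
... | true  = refl
... | false = refl
count-select p (x ∷ xs) = begin
  count p′ (map (true ∷_) ms ++ map (false ∷_) ms)
    ≡⟨ count-++ p′ (map (true ∷_) ms) _ ⟩
  count p′ (map (true ∷_) ms) + count p′ (map (false ∷_) ms)
    ≡⟨ cong₂ _+_ (count-map p′ (true ∷_) ms) (count-map p′ (false ∷_) ms) ⟩
  count (p′ ∘ (true ∷_)) ms + count (p′ ∘ (false ∷_)) ms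
    ≡⟨ cong₂ _+_ (count-select (p ∘ (x ∷_)) xs) (count-select p xs) ⟩
  sublistSum (x ∷ xs) (indicator ∘ p) ∎
  where
  open ≡-Reasoning
  ms = allBoolLists (length xs)
  p′ = λ mask → p (select (x ∷ xs) mask)

characteristic : ∀ {n} → List (Fin n) → Vec Bool n
characteristic V = Vec.tabulate λ v → does (_∈?_ _≟ᶠ_ v V)

characteristic-suc : ∀ {n} (V : List (Fin n)) →
  Vec.tabulate (λ v → does (_∈?_ _≟ᶠ_ (suc v) (map suc V))) ≡ characteristic V
characteristic-suc V = tabulate-cong λ v →
  does-⇔ (mk⇔ from (∈-map⁺ suc)) (_∈?_ _≟ᶠ_ (suc v) (map suc V)) (_∈?_ _≟ᶠ_ v V)
  where
  from : ∀ {v} → suc v ∈ map suc V → v ∈ V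
  from p with ∈-map⁻ suc p
  ... | _ , q , e = subst (_∈ V) (sym (sucᶠ-injective e)) q

sum-++ : ∀ (h : A → ℕ) xs ys →
  foldr _+_ 0 (map h (xs ++ ys)) ≡ foldr _+_ 0 (map h xs) + foldr _+_ 0 (map h ys)
sum-++ h []       ys = refl
sum-++ h (x ∷ xs) ys = trans (cong (h x +_) (sum-++ h xs ys)) (sym (+-assoc (h x) _ _))

-- Every Boolean vector is the characteristic vector of exactly one sublist of `allFin n`, and both
-- recursions branch on the first vertex, taken before left out.
sum-allVecs : ∀ n (h : Vec Bool n → ℕ) →
  foldr _+_ 0 (map h (allVecs n)) ≡ sublistSum (allFin n) (h ∘ characteristic)
sum-allVecs zero    h = +-identityʳ (h [])
sum-allVecs (suc n) h = begin
  foldr _+_ 0 (map h (map (true ∷_) vs ++ map (false ∷_) vs))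
    ≡⟨ sum-++ h (map (true ∷_) vs) (map (false ∷_) vs) ⟩
  foldr _+_ 0 (map h (map (true ∷_) vs)) + foldr _+_ 0 (map h (map (false ∷_) vs))
    ≡⟨ cong₂ _+_ (cong (foldr _+_ 0) (sym (map-∘ vs))) (cong (foldr _+_ 0) (sym (map-∘ vs))) ⟩
  foldr _+_ 0 (map (h ∘ (true ∷_)) vs) + foldr _+_ 0 (map (h ∘ (false ∷_)) vs)
    ≡⟨ cong₂ _+_ (sum-allVecs n (h ∘ (true ∷_))) (sum-allVecs n (h ∘ (false ∷_))) ⟩
  sublistSum (allFin n) (λ V → h (true ∷ characteristic V)) + sublistSum (allFin n) (λ V → h (false ∷ characteristic V))
    ≡⟨ cong₂ _+_
         (sublistSum-ext (allFin n) (λ V → cong h (cong₂ _∷_ (sym (with-zero V)) (sym (trans (tabulate-cong (drop-zero V)) (characteristic-suc V))))))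
         (sublistSum-ext (allFin n) (λ V → cong h (cong₂ _∷_ (sym (without-zero V)) (sym (characteristic-suc V))))) ⟩
  sublistSum (allFin n) (λ V → h (characteristic (zero ∷ map suc V))) + sublistSum (allFin n) (λ V → h (characteristic (map suc V)))
    ≡⟨ sym (cong₂ _+_ (sublistSum-map suc (allFin n) (λ V → h (characteristic (zero ∷ V))))
                      (sublistSum-map suc (allFin n) (h ∘ characteristic))) ⟩
  sublistSum (map suc (allFin n)) (λ V → h (characteristic (zero ∷ V))) + sublistSum (map suc (allFin n)) (h ∘ characteristic)
    ≡⟨ cong (λ l → sublistSum l (λ V → h (characteristic (zero ∷ V))) + sublistSum l (h ∘ characteristic))
            (map-tabulate id suc) ⟩
  sublistSum (allFin (suc n)) (h ∘ characteristic) ∎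
  where
  open ≡-Reasoning
  vs = allVecs n
  with-zero : ∀ V → does (_∈?_ _≟ᶠ_ zero (zero ∷ map suc V)) ≡ true
  with-zero V = dec-true (_∈?_ _≟ᶠ_ zero (zero ∷ map suc V)) (here refl)
  without-zero : ∀ V → does (_∈?_ _≟ᶠ_ (zero {n}) (map suc V)) ≡ false
  without-zero V = dec-false (_∈?_ _≟ᶠ_ zero (map suc V)) λ p → case′ (∈-map⁻ suc p)
    where
    case′ : ¬ (∃ λ v → v ∈ V × zero ≡ suc v)
    case′ (_ , _ , ())
  drop-zero : ∀ V (v : Fin n) →
    does (_∈?_ _≟ᶠ_ (suc v) (zero ∷ map suc V)) ≡ does (_∈?_ _≟ᶠ_ (suc v) (map suc V))
  drop-zero V v = does-⇔ (mk⇔ (λ { (there p) → p ; (here ()) }) there)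
    (_∈?_ _≟ᶠ_ (suc v) (zero ∷ map suc V)) (_∈?_ _≟ᶠ_ (suc v) (map suc V))

F-sublistSum : ∀ {n} (G : Graph n) →
  F G ≡ sublistSum (allFin n) λ V → sublistSum (edges G) λ E → indicator (isConnectedSub (characteristic V) E)
F-sublistSum {n} G = trans
  (sum-allVecs n _)
  (sublistSum-ext (allFin n) λ V → count-select (isConnectedSub (characteristic V)) (edges G))

-- Connected subgraphs as propositions

Edge : ℕ → Set
Edge n = Fin n × Fin n

flip : Edge n → Edge n
flip (a , b) = b , a

private
  variable
    u v p x y b : Fin n
    U V L : List (Fin n)
    E Es : List (Edge n)

-- Edges are ordered pairs that stand for unordered ones.
undirected : ℕ → Setoid 0ℓ 0ℓ
undirected n = record
  { Carrier = Edge n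
  ; _≈_ = λ e f → e ≡ f ⊎ e ≡ flip f
  ; isEquivalence = record
    { refl  = inj₁ refl
    ; sym   = λ { (inj₁ refl) → inj₁ refl ; (inj₂ refl) → inj₂ refl }
    ; trans = λ { (inj₁ refl) r → r ; (inj₂ refl) (inj₁ refl) → inj₂ refl ; (inj₂ refl) (inj₂ refl) → inj₁ refl }
    }
  }

module _ {n : ℕ} where
  open import Data.List.Membership.Setoid (undirected n) public using () renaming (_∈_ to _∈ₑ_)

Link : List (Edge n) → Fin n → Fin n → Set
Link E a b = (a , b) ∈ₑ E

link-sym : ∀ {E : List (Edge n)} {a b} → Link E a b → Link E b a
link-sym (here (inj₁ refl)) = here (inj₂ refl)
link-sym (here (inj₂ refl)) = here (inj₁ refl)
link-sym (there l)          = there (link-sym l)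

∈⇒link : ∀ {E : List (Edge n)} {a b} → (a , b) ∈ E → Link E a b
∈⇒link (here refl) = here (inj₁ refl)
∈⇒link (there p)   = there (∈⇒link p)

link⇒∈ : ∀ {E : List (Edge n)} {a b} → Link E a b → (a , b) ∈ E ⊎ (b , a) ∈ E
link⇒∈ (here (inj₁ refl)) = inj₁ (here refl)
link⇒∈ (here (inj₂ refl)) = inj₂ (here refl)
link⇒∈ (there l) = [ inj₁ ∘ there , inj₂ ∘ there ]′ (link⇒∈ l)

-- Links are symmetric, so naming one endpoint places both in `V`. The root serves at once for
-- nonemptiness and for connectedness.
Conn : List (Fin n) → List (Edge n) → Set
Conn V E = (∀ {a b} → Link E a b → a ∈ V) × ∃ λ r → r ∈ V × (∀ {w} → w ∈ V → Star (Link E) r w)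

∧-true : ∀ {x y} → x ∧ y ≡ true → x ≡ true × y ≡ true
∧-true {true} p = refl , p

∨-true : ∀ {x y} → x ∨ y ≡ true → x ≡ true ⊎ y ≡ true
∨-true {true}  p = inj₁ refl
∨-true {false} p = inj₂ p

∨-true₁ : ∀ {x y} → x ≡ true → x ∨ y ≡ true
∨-true₁ refl = refl

∨-true₂ : ∀ {x y} → y ≡ true → x ∨ y ≡ true
∨-true₂ {true}  p = refl
∨-true₂ {false} p = p

allList-true : ∀ {p : A → Bool} {xs} → (∀ {x} → x ∈ xs → p x ≡ true) → allList p xs ≡ true
allList-true {xs = []}     h = refl
allList-true {xs = x ∷ xs} h = cong₂ _∧_ (h (here refl)) (allList-true (h ∘ there))

allList-true⁻ : ∀ {p : A → Bool} {xs} → allList p xs ≡ true → ∀ {x} → x ∈ xs → p x ≡ true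
allList-true⁻ h (here refl) = proj₁ (∧-true h)
allList-true⁻ h (there q)   = allList-true⁻ (proj₂ (∧-true h)) q

anyList-true : ∀ {p : A → Bool} {xs x} → x ∈ xs → p x ≡ true → anyList p xs ≡ true
anyList-true (here refl) h = ∨-true₁ h
anyList-true {p = p} {y ∷ _} (there q) h = ∨-true₂ {p y} (anyList-true q h)

anyList-true⁻ : ∀ {p : A → Bool} {xs} → anyList p xs ≡ true → ∃ λ x → x ∈ xs × p x ≡ true
anyList-true⁻ {p = p} {x ∷ xs} h with ∨-true {p x} h
... | inj₁ q = x , here refl , q
... | inj₂ q with anyList-true⁻ {xs = xs} q
...   | y , y∈ , r = y , there y∈ , r

eqFin-true : ∀ {i j : Fin n} → i ≡ j → eqFin i j ≡ true
eqFin-true {i = i} {j} = dec-true (i ≟ᶠ j)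

eqFin-true⁻ : ∀ {i j : Fin n} → eqFin i j ≡ true → i ≡ j
eqFin-true⁻ {i = i} {j} h with i ≟ᶠ j
... | yes p = p

module _ (E : List (Edge n)) where

  expand-⊇ : ∀ R {y} → lookup R y ≡ true → lookup (expand E R) y ≡ true
  expand-⊇ R {y} h = trans (lookup∘tabulate _ y) (∨-true₁ h)

  expand-link : ∀ R {a y} → Link E a y → lookup R a ≡ true → lookup (expand E R) y ≡ true
  expand-link R {a} {y} l h = trans (lookup∘tabulate _ y) (∨-true₂ {lookup R y} (step′ (link⇒∈ l)))
    where
    step′ : _ → _
    step′ (inj₁ p) = anyList-true p (∨-true₁ (cong₂ _∧_ (eqFin-true {i = y} refl) h))
    step′ (inj₂ p) = anyList-true p (∨-true₂ {eqFin a y ∧ lookup R y} (cong₂ _∧_ (eqFin-true {i = y} refl) h))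

  expand⁻ : ∀ {R y} → lookup (expand E R) y ≡ true →
    lookup R y ≡ true ⊎ ∃ λ a → Link E a y × lookup R a ≡ true
  expand⁻ {R} {y} h with ∨-true {lookup R y} (trans (sym (lookup∘tabulate _ y)) h)
  ... | inj₁ p = inj₁ p
  ... | inj₂ p with anyList-true⁻ {xs = E} p
  ...   | (a , b) , e∈ , q with ∨-true {eqFin b y ∧ lookup R a} q
  ...     | inj₁ r with ∧-true {eqFin b y} r
  ...       | b≡y , ra = inj₂ (a , subst (Link E a) (eqFin-true⁻ b≡y) (∈⇒link e∈) , ra)
  expand⁻ {R} {y} h | inj₂ p | (a , b) , e∈ , q | inj₂ r with ∧-true {eqFin a y} r
  ...       | a≡y , rb = inj₂ (b , subst (Link E b) (eqFin-true⁻ a≡y) (link-sym (∈⇒link e∈)) , rb)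

  module _ (v : Fin n) where

    stage : ℕ → Subset n
    stage k = iterate k (expand E) (Vec.tabulate (eqFin v))

    stage-start : ∀ k → lookup (stage k) v ≡ true
    stage-start zero    = trans (lookup∘tabulate _ v) (eqFin-true {i = v} refl)
    stage-start (suc k) = expand-⊇ (stage k) (stage-start k)

    stage-sound : ∀ k {w} → lookup (stage k) w ≡ true → Star (Link E) v w
    stage-sound zero {w} h with eqFin-true⁻ {i = v} {w} (trans (sym (lookup∘tabulate _ w)) h)
    ... | refl = ε
    stage-sound (suc k) h with expand⁻ {stage k} h
    ... | inj₁ p           = stage-sound k p
    ... | inj₂ (a , l , p) = stage-sound k p ◅◅ (l ◅ ε)

    -- Each stage that is not yet closed has gained a vertex.
    stage-grows : ∀ k → expand E (stage k) ≡ stage k ⊎ k < ∣ stage k ∣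
    stage-grows zero    = inj₂ (nonempty (lookup⇒[]= v (stage 0) (stage-start 0)))
      where
      nonempty : ∀ {m} {p : Subset m} {x} → x ∈ₛ p → 0 < ∣ p ∣
      nonempty Vec.here = s≤s z≤n
      nonempty {p = true ∷ p}  (Vec.there q) = s≤s z≤n
      nonempty {p = false ∷ p} (Vec.there q) = nonempty q
    stage-grows (suc k) with stage-grows k
    ... | inj₁ fix = inj₁ (cong (expand E) fix)
    ... | inj₂ k< with any? (λ y → (lookup (expand E (stage k)) y Bool.≟ true) ×-dec ¬? (lookup (stage k) y Bool.≟ true))
    ...   | yes (y , y∈ , y∉) = inj₂ (≤-<-trans k< (p⊂q⇒∣p∣<∣q∣ {p = stage k} {stage (suc k)}
              ( (λ {x} p → lookup⇒[]= x _ (expand-⊇ (stage k) ([]=⇒lookup p)))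
              , y , lookup⇒[]= y _ y∈ , y∉ ∘ []=⇒lookup)))
    ...   | no ¬new = inj₁ (cong (expand E) (⊆-antisym {i = stage (suc k)} {stage k}
              (λ {x} p → lookup⇒[]= x _ (old ([]=⇒lookup p)))
              (λ {x} p → lookup⇒[]= x _ (expand-⊇ (stage k) ([]=⇒lookup p)))))
      where
      old : ∀ {y} → lookup (expand E (stage k)) y ≡ true → lookup (stage k) y ≡ true
      old {y} h with lookup (stage k) y Bool.≟ true
      ... | yes p = p
      ... | no ¬p = contradiction (y , h , ¬p) ¬new

    -- A stage `n` that were not yet closed would hold more than `n` vertices.
    reachFrom-closed : expand E (reachFrom E v) ≡ reachFrom E v
    reachFrom-closed with stage-grows n
    ... | inj₁ fix = fix
    ... | inj₂ n<  = contradiction n< (≤⇒≯ (∣p∣≤n (stage n)))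

    reachFrom-complete : ∀ {w} → Star (Link E) v w → lookup (reachFrom E v) w ≡ true
    reachFrom-complete = go (stage-start n)
      where
      go : ∀ {u w} → lookup (reachFrom E v) u ≡ true → Star (Link E) u w → lookup (reachFrom E v) w ≡ true
      go h ε        = h
      go h (l ◅ ls) = go (trans (cong (λ R → lookup R _) (sym reachFrom-closed)) (expand-link (reachFrom E v) l h)) ls

lookup-characteristic : ∀ {V : List (Fin n)} {v} → v ∈ V → lookup (characteristic V) v ≡ true
lookup-characteristic {V = V} {v} p = trans (lookup∘tabulate _ v) (dec-true (_∈?_ _≟ᶠ_ v V) p)

lookup-characteristic⁻ : ∀ {V : List (Fin n)} {v} → lookup (characteristic V) v ≡ true → v ∈ V
lookup-characteristic⁻ {V = V} {v} h with _∈?_ _≟ᶠ_ v V | trans (sym (lookup∘tabulate _ v)) h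
... | yes p | _ = p

isConnectedSub-sound : ∀ {V : List (Fin n)} {E} → isConnectedSub (characteristic V) E ≡ true → Conn V E
isConnectedSub-sound {n} {V} {E} h with ∧-true h
... | inside? , root? with anyList-true⁻ {xs = allFin n} root?
...   | r , _ , hr with ∧-true hr
...     | r∈ , all-w = inside , r , lookup-characteristic⁻ r∈ , reach
  where
  inside : ∀ {a b} → Link E a b → a ∈ V
  inside l with link⇒∈ l
  ... | inj₁ p = lookup-characteristic⁻ (proj₁ (∧-true (allList-true⁻ inside? p)))
  ... | inj₂ p = lookup-characteristic⁻ (proj₂ (∧-true (allList-true⁻ inside? p)))
  reach : ∀ {w} → w ∈ V → Star (Link E) r w
  reach {w} w∈ with ∨-true (allList-true⁻ all-w (∈-allFin w))
  ... | inj₂ p = stage-sound E r n p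
  ... | inj₁ p with trans (sym p) (cong not (lookup-characteristic w∈))
  ...   | ()

isConnectedSub-complete : ∀ {V : List (Fin n)} {E} → Conn V E → isConnectedSub (characteristic V) E ≡ true
isConnectedSub-complete {V = V} {E} (inside , r , r∈ , reach) = cong₂ _∧_
  (allList-true λ p → cong₂ _∧_ (lookup-characteristic (inside (∈⇒link p)))
                                (lookup-characteristic (inside (link-sym (∈⇒link p)))))
  (anyList-true (∈-allFin r) (cong₂ _∧_ (lookup-characteristic r∈) (allList-true {xs = allFin _} λ {w} _ → covered w)))
  where
  covered : ∀ w → not (lookup (characteristic V) w) ∨ lookup (reachFrom E r) w ≡ true
  covered w with lookup (characteristic V) w in eq
  ... | true  = reachFrom-complete E r (reach (lookup-characteristic⁻ eq))
  ... | false = refl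

conn? : ∀ (V : List (Fin n)) E → Dec (Conn V E)
conn? V E with isConnectedSub (characteristic V) E in eq
... | true  = yes (isConnectedSub-sound eq)
... | false = no λ c → contradiction (trans (sym eq) (isConnectedSub-complete c)) λ ()

-- `U` holds the vertices that the subgraph is required to contain. Keeping it a list lets totals,
-- counts through one vertex and counts through two vertices share their lemmas.
Spans : List (Fin n) → List (Fin n) → List (Edge n) → Set
Spans U V E = Conn V E × All (_∈ V) U

-- The decision procedure is kept opaque: later counts are compared only through equivalences of
-- `Spans`, never by evaluating the search.
abstract
  spans? : ∀ (U V : List (Fin n)) E → Dec (Spans U V E)
  spans? U V E = conn? V E ×-dec all? (λ u → _∈?_ _≟ᶠ_ u V) U

χ : List (Fin n) → List (Fin n) → List (Edge n) → ℕ
χ U V E = indicator (does (spans? U V E))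

subgraphs : List (Fin n) → List (Fin n) → List (Edge n) → ℕ
subgraphs U L Es = sublistSum L λ V → sublistSum Es λ E → χ U V E

χ-cong : ∀ {U′ V′ : List (Fin n)} {E′} → (Spans U V E → Spans U′ V′ E′) → (Spans U′ V′ E′ → Spans U V E) →
  χ U V E ≡ χ U′ V′ E′
χ-cong to from = cong indicator (does-⇔ (mk⇔ to from) (spans? _ _ _) (spans? _ _ _))

χ-1 : Spans U V E → χ U V E ≡ 1
χ-1 s = cong indicator (dec-true (spans? _ _ _) s)

χ-0 : ¬ Spans U V E → χ U V E ≡ 0
χ-0 ¬s = cong indicator (dec-false (spans? _ _ _) ¬s)

χ-mono : ∀ {U′ : List (Fin n)} → (Spans U V E → Spans U′ V E) → χ U V E ≤ χ U′ V E
χ-mono {U = U} {V} {E} {U′} to = indicator-mono (spans? U V E) (spans? U′ V E)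
  where
  indicator-mono : (s? : Dec (Spans U V E)) (s′? : Dec (Spans U′ V E)) → indicator (does s?) ≤ indicator (does s′?)
  indicator-mono (no _)  _       = z≤n
  indicator-mono (yes s) (yes _) = ≤-refl
  indicator-mono (yes s) (no ¬s) = contradiction (to s) ¬s

F-subgraphs : ∀ (G : Graph n) → F G ≡ subgraphs [] (allFin n) (edges G)
F-subgraphs {n} G = trans (F-sublistSum G)
  (sublistSum-ext (allFin n) λ V → sublistSum-ext (edges G) λ E → agree V E)
  where
  agree : ∀ V E → indicator (isConnectedSub (characteristic V) E) ≡ χ [] V E
  agree V E with isConnectedSub (characteristic V) E in eq
  ... | true  = sym (χ-1 (isConnectedSub-sound eq , []))
  ... | false = sym (χ-0 λ s → contradiction (trans (sym eq) (isConnectedSub-complete (proj₁ s))) λ ())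

-- Local surgery: removing a leaf, suppressing a vertex of degree two

Fresh : Fin n → List (Fin n) → Set
Fresh v = All (v ≢_)

Avoids : Fin n → List (Edge n) → Set
Avoids v = All λ e → v ≢ proj₁ e × v ≢ proj₂ e

avoids-link : Avoids v E → ∀ {a b} → Link E a b → v ≢ a × v ≢ b
avoids-link (p ∷ ps) (here (inj₁ refl)) = p
avoids-link (p ∷ ps) (here (inj₂ refl)) = proj₂ p , proj₁ p
avoids-link (p ∷ ps) (there l)          = avoids-link ps l

fresh-∉ : Fresh v V → v ∉ V
fresh-∉ (v≢ ∷ fr) (here refl) = v≢ refl
fresh-∉ (v≢ ∷ fr) (there q)   = fresh-∉ fr q

∈-strip : v ≢ x → x ∈ v ∷ V → x ∈ V
∈-strip v≢x (here refl) = contradiction refl v≢x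
∈-strip v≢x (there q)   = q

conn-reach : Conn V E → ∀ {a b} → a ∈ V → b ∈ V → Star (Link E) a b
conn-reach (_ , _ , _ , reach) a∈ b∈ = reverse link-sym (reach a∈) ◅◅ reach b∈

conn-endpoint : Conn V ((x , y) ∷ E) → x ∈ V × y ∈ V
conn-endpoint (inside , _) = inside (here (inj₁ refl)) , inside (here (inj₂ refl))

merge : Fin n → Fin n → Fin n → Fin n
merge v p x = if does (v ≟ᶠ x) then p else x

merge-≢ : ∀ (p : Fin n) → v ≢ x → merge v p x ≡ x
merge-≢ {v = v} {x} p v≢x = cong (if_then p else x) (dec-false (v ≟ᶠ x) v≢x)

-- Moving `v` onto `p` sends every step of a walk to a walk in `E′`. The walk may pass through `v`
-- any number of times, so no detour has to be located and cut out.
contract-walk : ∀ {E′ : List (Edge n)} →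
  (∀ {a b} → v ≢ a → v ≢ b → Link E a b → Link E′ a b) →
  (∀ {b} → v ≢ b → Link E v b → Star (Link E′) p b) →
  ∀ {a b} → v ≢ a → v ≢ b → Star (Link E) a b → Star (Link E′) a b
contract-walk {v = v} {E} {p} {E′} keep redirect {a} {b} v≢a v≢b walk =
  subst₂ (Star (Link E′)) (merge-≢ p v≢a) (merge-≢ p v≢b) (kleisliStar (merge v p) edge walk)
  where
  edge : ∀ {a b} → Link E a b → Star (Link E′) (merge v p a) (merge v p b)
  edge {a} {b} l with v ≟ᶠ a | v ≟ᶠ b
  ... | yes _    | yes _    = ε
  ... | yes refl | no v≢b   = redirect v≢b l
  ... | no v≢a   | yes refl = reverse link-sym (redirect v≢a (link-sym l))
  ... | no v≢a   | no v≢b   = keep v≢a v≢b l ◅ ε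

conn-leaf : Fresh v V → Avoids v E → v ≢ p → Conn (v ∷ V) ((v , p) ∷ E) → Conn V E × p ∈ V
conn-leaf {v = v} {V} {E} {p} fr av v≢p c = (inside , p , p∈ , reach) , p∈
  where
  p∈ : p ∈ V
  p∈ = ∈-strip v≢p (proj₂ (conn-endpoint c))
  inside : ∀ {a b} → Link E a b → a ∈ V
  inside l = ∈-strip (proj₁ (avoids-link av l)) (proj₁ c (there l))
  keep : ∀ {a b} → v ≢ a → v ≢ b → Link ((v , p) ∷ E) a b → Link E a b
  keep v≢a v≢b (here (inj₁ refl)) = contradiction refl v≢a
  keep v≢a v≢b (here (inj₂ refl)) = contradiction refl v≢b
  keep v≢a v≢b (there l)          = l
  redirect : ∀ {b} → v ≢ b → Link ((v , p) ∷ E) v b → Star (Link E) p b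
  redirect v≢b (here (inj₁ refl)) = ε
  redirect v≢b (here (inj₂ refl)) = contradiction refl v≢b
  redirect v≢b (there l)          = contradiction refl (proj₁ (avoids-link av l))
  reach : ∀ {w} → w ∈ V → Star (Link E) p w
  reach w∈ = contract-walk keep redirect v≢p (All.lookup fr w∈) (conn-reach c (there p∈) (there w∈))

conn-leaf⁻ : Conn V E → p ∈ V → Conn (v ∷ V) ((v , p) ∷ E)
conn-leaf⁻ {V = V} {E} {p} {v} c p∈ = inside , p , there p∈ , reach
  where
  inside : ∀ {a b} → Link ((v , p) ∷ E) a b → a ∈ v ∷ V
  inside (here (inj₁ refl)) = here refl
  inside (here (inj₂ refl)) = there p∈
  inside (there l)          = there (proj₁ c l)
  reach : ∀ {w} → w ∈ v ∷ V → Star (Link ((v , p) ∷ E)) p w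
  reach (here refl) = here (inj₂ refl) ◅ ε
  reach (there w∈)  = kleisliStar id (λ l → there l ◅ ε) (conn-reach c p∈ w∈)

-- Contracting `x` into `y` collapses the edge from `x` to `y` and turns the one from `x` to `b`
-- into one from `y` to `b`. The case `y ≡ b`, where the new edge is a loop, is allowed.
conn-suppress : Fresh x V → Avoids x E → x ≢ y → x ≢ b →
  Conn (x ∷ V) ((x , b) ∷ (x , y) ∷ E) → Conn V ((y , b) ∷ E)
conn-suppress {x = x} {V} {E} {y} {b} fr av x≢y x≢b c = inside , y , y∈ , reach
  where
  y∈ : y ∈ V
  y∈ = ∈-strip x≢y (proj₁ c (there (here (inj₂ refl))))
  inside : ∀ {a c} → Link ((y , b) ∷ E) a c → a ∈ V
  inside (here (inj₁ refl)) = y∈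
  inside (here (inj₂ refl)) = ∈-strip x≢b (proj₂ (conn-endpoint c))
  inside (there l) = ∈-strip (proj₁ (avoids-link av l)) (proj₁ c (there (there l)))
  keep : ∀ {a c} → x ≢ a → x ≢ c → Link ((x , b) ∷ (x , y) ∷ E) a c → Link ((y , b) ∷ E) a c
  keep x≢a x≢c (here (inj₁ refl))         = contradiction refl x≢a
  keep x≢a x≢c (here (inj₂ refl))         = contradiction refl x≢c
  keep x≢a x≢c (there (here (inj₁ refl))) = contradiction refl x≢a
  keep x≢a x≢c (there (here (inj₂ refl))) = contradiction refl x≢c
  keep x≢a x≢c (there (there l))          = there l
  redirect : ∀ {c} → x ≢ c → Link ((x , b) ∷ (x , y) ∷ E) x c → Star (Link ((y , b) ∷ E)) y c
  redirect x≢c (here (inj₁ refl))         = here (inj₁ refl) ◅ ε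
  redirect x≢c (here (inj₂ refl))         = contradiction refl x≢c
  redirect x≢c (there (here (inj₁ refl))) = ε
  redirect x≢c (there (here (inj₂ refl))) = contradiction refl x≢c
  redirect x≢c (there (there l))          = contradiction refl (proj₁ (avoids-link av l))
  reach : ∀ {w} → w ∈ V → Star (Link ((y , b) ∷ E)) y w
  reach w∈ = contract-walk keep redirect x≢y (All.lookup fr w∈) (conn-reach c (there y∈) (there w∈))

conn-subdivide : Conn V ((y , b) ∷ E) → Conn (x ∷ V) ((x , b) ∷ (x , y) ∷ E)
conn-subdivide {V = V} {y} {b} {E} {x} c = inside , y , there y∈ , reach
  where
  y∈ = proj₁ (conn-endpoint c)
  inside : ∀ {a c} → Link ((x , b) ∷ (x , y) ∷ E) a c → a ∈ x ∷ V
  inside (here (inj₁ refl))         = here refl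
  inside (here (inj₂ refl))         = there (proj₂ (conn-endpoint c))
  inside (there (here (inj₁ refl))) = here refl
  inside (there (here (inj₂ refl))) = there y∈
  inside (there (there l))          = there (proj₁ c (there l))
  detour : ∀ {a c} → Link ((y , b) ∷ E) a c → Star (Link ((x , b) ∷ (x , y) ∷ E)) a c
  detour (here (inj₁ refl)) = there (here (inj₂ refl)) ◅ here (inj₁ refl) ◅ ε
  detour (here (inj₂ refl)) = here (inj₂ refl) ◅ there (here (inj₁ refl)) ◅ ε
  detour (there l)          = there (there l) ◅ ε
  reach : ∀ {w} → w ∈ x ∷ V → Star (Link ((x , b) ∷ (x , y) ∷ E)) y w
  reach (here refl) = there (here (inj₂ refl)) ◅ ε
  reach (there w∈)  = kleisliStar id detour (conn-reach c y∈ w∈)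

-- A walk out of `v` would have to begin with a link at `v`, so `v` is the only vertex; any edge
-- would then have `v` as an endpoint.
conn-isolated : Fresh v V → Avoids v E → Conn (v ∷ V) E → V ≡ [] × E ≡ []
conn-isolated {V = []}    {[]}          fr av c = refl , refl
conn-isolated {V = []}    {(a , b) ∷ E} fr av c with proj₁ (conn-endpoint c)
... | here refl = contradiction refl (proj₁ (avoids-link av (here (inj₁ refl))))
conn-isolated {V = w ∷ V} (v≢w ∷ fr) av c with conn-reach c (here refl) (there (here refl))
... | ε     = contradiction refl v≢w
... | l ◅ _ = contradiction refl (proj₁ (avoids-link av l))

conn-single : Conn {n} (v ∷ []) []
conn-single = (λ ()) , _ , here refl , λ { (here refl) → ε }

-- The recurrence for attaching a leaf

only : ℕ → List A → ℕ
only c []      = c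
only c (_ ∷ _) = 0

sublistSum-only : ∀ c (xs : List A) → sublistSum xs (only c) ≡ c
sublistSum-only c []       = refl
sublistSum-only c (x ∷ xs) = cong₂ _+_ (sublistSum-0 xs) (sublistSum-only c xs)

sublistSum₂-only : ∀ c (L : List (Fin n)) (Es : List (Edge n)) →
  sublistSum L (λ V → sublistSum Es (only (only c V))) ≡ c
sublistSum₂-only c L Es = trans (sublistSum-ext L λ V → sublistSum-only (only c V) Es) (sublistSum-only c L)

χ-leaf : Fresh v V → Avoids v E → v ≢ p → Fresh v U → χ U (v ∷ V) ((v , p) ∷ E) ≡ χ (p ∷ U) V E
χ-leaf fr av v≢p frU = χ-cong
  (λ (c , us) → let c′ , p∈ = conn-leaf fr av v≢p c in
     c′ , p∈ ∷ All.zipWith (λ (v≢u , u∈) → ∈-strip v≢u u∈) (frU , us))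
  (λ { (c , p∈ ∷ us) → conn-leaf⁻ c p∈ , All.map there us })

χ-isolated : Fresh v V → Avoids v E → Fresh v U → χ U (v ∷ V) E ≡ only (only (only 1 U) V) E
χ-isolated {V = []} {[]}    {[]}    fr av frU = χ-1 (conn-single , [])
χ-isolated {V = []} {[]}    {u ∷ U} fr av (v≢u ∷ _) = χ-0 λ { (_ , here refl ∷ _) → v≢u refl }
χ-isolated {V = []} {_ ∷ _} fr av frU = χ-0 λ (c , _) → contradiction (proj₂ (conn-isolated fr av c)) λ ()
χ-isolated {V = w ∷ V} {E}  fr av frU =
  trans (χ-0 λ (c , _) → contradiction (proj₁ (conn-isolated fr av c)) λ ()) (sym (only-0 E))
  where
  only-0 : ∀ (xs : List A) → only 0 xs ≡ 0
  only-0 []      = refl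
  only-0 (_ ∷ _) = refl

χ-dangling : v ∉ V → χ U V ((v , p) ∷ E) ≡ 0
χ-dangling v∉ = χ-0 λ (c , _) → v∉ (proj₁ (conn-endpoint c))

-- Four cases: vertex and edge both chosen leave a subgraph that contains `p`; the vertex alone
-- leaves just itself, admissible only if nothing is required; the edge alone is impossible; neither
-- leaves an old subgraph.
subgraphs-leaf : Fresh v L → Avoids v Es → v ≢ p → Fresh v U →
  subgraphs U (v ∷ L) ((v , p) ∷ Es) ≡ (subgraphs (p ∷ U) L Es + only 1 U) + subgraphs U L Es
subgraphs-leaf {v = v} {L} {Es} {p} {U} frL avEs v≢p frU = cong₂ _+_
  (begin
    sublistSum L (λ V → sublistSum Es (λ E → χ U (v ∷ V) ((v , p) ∷ E)) + sublistSum Es (χ U (v ∷ V)))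
      ≡⟨ sublistSum-cong frL (λ fr → cong₂ _+_
           (sublistSum-cong avEs λ av → χ-leaf fr av v≢p frU)
           (sublistSum-cong avEs λ av → χ-isolated fr av frU)) ⟩
    sublistSum L (λ V → sublistSum Es (χ (p ∷ U) V) + sublistSum Es (only (only (only 1 U) V)))
      ≡⟨ sublistSum-+ L _ _ ⟩
    subgraphs (p ∷ U) L Es + sublistSum L (λ V → sublistSum Es (only (only (only 1 U) V)))
      ≡⟨ cong (subgraphs (p ∷ U) L Es +_) (sublistSum₂-only (only 1 U) L Es) ⟩
    subgraphs (p ∷ U) L Es + only 1 U ∎)
  (sublistSum-cong frL λ fr → cong (_+ _)
     (trans (sublistSum-ext Es λ E → χ-dangling (fresh-∉ fr)) (sublistSum-0 Es)))
  where open ≡-Reasoning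

-- Requiring `v` removes the two cases without `v` and imposes nothing on the other two.
subgraphs-leaf-self : Fresh v L → Avoids v Es → v ≢ p → Fresh v U →
  subgraphs (v ∷ U) (v ∷ L) ((v , p) ∷ Es) ≡ subgraphs (p ∷ U) L Es + only 1 U
subgraphs-leaf-self {v = v} {L} {Es} {p} {U} frL avEs v≢p frU = begin
  sublistSum L (λ V → sublistSum Es (λ E → χ (v ∷ U) (v ∷ V) ((v , p) ∷ E)) + sublistSum Es (χ (v ∷ U) (v ∷ V)))
    + sublistSum L (λ V → sublistSum Es (λ E → χ (v ∷ U) V ((v , p) ∷ E)) + sublistSum Es (χ (v ∷ U) V))
    ≡⟨ cong₂ _+_
         (sublistSum-cong frL (λ fr → cong₂ _+_
           (sublistSum-cong avEs λ av → trans drop-self (χ-leaf fr av v≢p frU))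
           (sublistSum-cong avEs λ av → trans drop-self (χ-isolated fr av frU))))
         (sublistSum-cong frL (λ fr → cong₂ _+_
           (trans (sublistSum-ext Es λ E → χ-dangling (fresh-∉ fr)) (sublistSum-0 Es))
           (trans (sublistSum-ext Es λ E → χ-0 λ { (_ , v∈ ∷ _) → fresh-∉ fr v∈ }) (sublistSum-0 Es)))) ⟩
  sublistSum L (λ V → sublistSum Es (χ (p ∷ U) V) + sublistSum Es (only (only (only 1 U) V)))
    + sublistSum L (λ _ → 0)
    ≡⟨ cong₂ _+_ (sublistSum-+ L _ _) (sublistSum-0 L) ⟩
  subgraphs (p ∷ U) L Es + sublistSum L (λ V → sublistSum Es (only (only (only 1 U) V))) + 0
    ≡⟨ +-identityʳ _ ⟩
  subgraphs (p ∷ U) L Es + sublistSum L (λ V → sublistSum Es (only (only (only 1 U) V)))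
    ≡⟨ cong (subgraphs (p ∷ U) L Es +_) (sublistSum₂-only (only 1 U) L Es) ⟩
  subgraphs (p ∷ U) L Es + only 1 U ∎
  where
  open ≡-Reasoning
  drop-self : ∀ {V E} → χ (v ∷ U) (v ∷ V) E ≡ χ U (v ∷ V) E
  drop-self = χ-cong (λ { (c , _ ∷ us) → c , us }) (λ (c , us) → c , here refl ∷ us)

-- Paths and cycles

first : List A → A → A
first []      b = b
first (x ∷ _) b = x

-- The last vertex is kept apart, so the path is never empty and each earlier vertex is a leaf
-- attached to the rest at `first xs b`.
pathEdges : List A → A → List (A × A)
pathEdges []       b = []
pathEdges (x ∷ xs) b = (x , first xs b) ∷ pathEdges xs b

cycleEdges : List A → A → List (A × A)
cycleEdges xs b = (first xs b , b) ∷ pathEdges xs b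

triangular : ℕ → ℕ
triangular zero    = 0
triangular (suc k) = suc k + triangular k

fresh-first : ∀ xs → Fresh v (xs ∷ʳ b) → v ≢ first xs b
fresh-first []       (q ∷ _) = q
fresh-first (x ∷ xs) (q ∷ _) = q

fresh-last : ∀ xs → Fresh v (xs ∷ʳ b) → v ≢ b
fresh-last []       (q ∷ _)  = q
fresh-last (x ∷ xs) (_ ∷ fr) = fresh-last xs fr

avoids-path : ∀ xs → Fresh v (xs ∷ʳ b) → Avoids v (pathEdges xs b)
avoids-path []       fr       = []
avoids-path (x ∷ xs) (q ∷ fr) = (q , fresh-first xs fr) ∷ avoids-path xs fr

path-through-first : ∀ xs → Unique (xs ∷ʳ b) →
  subgraphs (first xs b ∷ []) (xs ∷ʳ b) (pathEdges xs b) ≡ suc (length xs)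
path-through-first [] uq = cong₂ _+_ (χ-1 (conn-single , here refl ∷ [])) (χ-0 λ { (_ , () ∷ _) })
path-through-first (x ∷ xs) (fr ∷ uq) = trans
  (subgraphs-leaf-self fr (avoids-path xs fr) (fresh-first xs fr) [])
  (trans (cong (_+ 1) (path-through-first xs uq)) (+-comm _ 1))

path-through-ends : ∀ xs → Unique (xs ∷ʳ b) →
  subgraphs (first xs b ∷ b ∷ []) (xs ∷ʳ b) (pathEdges xs b) ≡ 1
path-through-ends [] uq = cong₂ _+_ (χ-1 (conn-single , here refl ∷ here refl ∷ [])) (χ-0 λ { (_ , () ∷ _) })
path-through-ends (x ∷ xs) (fr ∷ uq) = trans
  (subgraphs-leaf-self fr (avoids-path xs fr) (fresh-first xs fr) (fresh-last xs fr ∷ []))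
  (trans (+-identityʳ _) (path-through-ends xs uq))

-- Vertices are removed at the far end from `b`, and a subpath that contains both `b` and the
-- removed vertex can only be the whole path.
path-through-last : ∀ xs → Unique (xs ∷ʳ b) →
  subgraphs (b ∷ []) (xs ∷ʳ b) (pathEdges xs b) ≡ suc (length xs)
path-through-last [] uq = path-through-first [] uq
path-through-last (x ∷ xs) (fr ∷ uq) = trans
  (subgraphs-leaf fr (avoids-path xs fr) (fresh-first xs fr) (fresh-last xs fr ∷ []))
  (cong₂ _+_ (trans (+-identityʳ _) (path-through-ends xs uq)) (path-through-last xs uq))

path-total : ∀ xs → Unique (xs ∷ʳ b) →
  subgraphs [] (xs ∷ʳ b) (pathEdges xs b) ≡ triangular (suc (length xs))
path-total [] uq = cong₂ _+_ (χ-1 (conn-single , [])) (χ-0 λ { ((_ , _ , () , _) , _) })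
path-total (x ∷ xs) (fr ∷ uq) = trans
  (subgraphs-leaf fr (avoids-path xs fr) (fresh-first xs fr) [])
  (cong₂ _+_ (trans (cong (_+ 1) (path-through-first xs uq)) (+-comm (suc (length xs)) 1)) (path-total xs uq))

-- Suppressing the first vertex of the path, when both its edges are chosen, turns the count for a
-- cycle into the count for a shorter one; the degenerate end of the recursion is a loop at b.
cycle-closing : ∀ xs → Unique (xs ∷ʳ b) →
  sublistSum (xs ∷ʳ b) (λ V → sublistSum (pathEdges xs b) λ E → χ [] V ((first xs b , b) ∷ E))
    ≡ suc (triangular (length xs))
cycle-closing {b = b} [] uq = cong₂ _+_
  (χ-1 (((λ { (here (inj₁ refl)) → here refl ; (here (inj₂ refl)) → here refl })
       , b , here refl , λ { (here refl) → ε }) , []))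
  (χ-0 λ { ((_ , _ , () , _) , _) })
cycle-closing {b = b} (x ∷ xs) (fr ∷ uq) = begin
  sublistSum L′ (λ V → sublistSum Es′ (λ E → χ [] (x ∷ V) ((x , b) ∷ (x , y′) ∷ E))
                    + sublistSum Es′ (λ E → χ [] (x ∷ V) ((x , b) ∷ E)))
    + sublistSum L′ (λ V → sublistSum ((x , y′) ∷ Es′) (λ E → χ [] V ((x , b) ∷ E)))
    ≡⟨ cong₂ _+_
         (sublistSum-cong fr λ frV → cong₂ _+_
           (sublistSum-cong av λ avE → χ-cong
             (λ (c , _) → conn-suppress frV avE (fresh-first xs fr) (fresh-last xs fr) c , [])
             (λ (c , _) → conn-subdivide c , []))
           (sublistSum-cong av λ avE → χ-leaf frV avE (fresh-last xs fr) []))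
         (trans
           (sublistSum-cong fr λ frV →
             trans (sublistSum-ext ((x , y′) ∷ Es′) λ E → χ-dangling (fresh-∉ frV)) (sublistSum-0 ((x , y′) ∷ Es′)))
           (sublistSum-0 L′)) ⟩
  sublistSum L′ (λ V → sublistSum Es′ (λ E → χ [] V ((y′ , b) ∷ E)) + sublistSum Es′ (χ (b ∷ []) V)) + 0
    ≡⟨ +-identityʳ _ ⟩
  sublistSum L′ (λ V → sublistSum Es′ (λ E → χ [] V ((y′ , b) ∷ E)) + sublistSum Es′ (χ (b ∷ []) V))
    ≡⟨ sublistSum-+ L′ _ _ ⟩
  sublistSum L′ (λ V → sublistSum Es′ (λ E → χ [] V ((y′ , b) ∷ E))) + subgraphs (b ∷ []) L′ Es′
    ≡⟨ cong₂ _+_ (cycle-closing xs uq) (path-through-last xs uq) ⟩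
  suc (triangular (length xs)) + suc (length xs)
    ≡⟨ cong suc (+-comm (triangular (length xs)) _) ⟩
  suc (triangular (length (x ∷ xs))) ∎
  where
  open ≡-Reasoning
  L′ = xs ∷ʳ b
  Es′ = pathEdges xs b
  y′ = first xs b
  av = avoids-path xs fr

cycle-total : ∀ xs → Unique (xs ∷ʳ b) → subgraphs [] (xs ∷ʳ b) (cycleEdges xs b)
  ≡ suc (triangular (length xs)) + triangular (suc (length xs))
cycle-total xs uq = trans (sublistSum-+ (xs ∷ʳ _) _ _) (cong₂ _+_ (cycle-closing xs uq) (path-total xs uq))

-- A subgraph that uses the closing edge contains `b` automatically, so for these the requirement
-- costs nothing; the others live on the path that ends at `b`.
cycle-through-last : ∀ xs → Unique (xs ∷ʳ b) → subgraphs (b ∷ []) (xs ∷ʳ b) (cycleEdges xs b)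
  ≡ suc (triangular (suc (length xs)))
cycle-through-last {b = b} xs uq = begin
  subgraphs (b ∷ []) (xs ∷ʳ b) (cycleEdges xs b)
    ≡⟨ sublistSum-+ (xs ∷ʳ _) _ _ ⟩
  sublistSum (xs ∷ʳ b) (λ V → sublistSum (pathEdges xs b) λ E → χ (b ∷ []) V ((first xs b , b) ∷ E))
    + subgraphs (b ∷ []) (xs ∷ʳ b) (pathEdges xs b)
    ≡⟨ cong₂ _+_
         (trans (sublistSum-ext (xs ∷ʳ b) λ V → sublistSum-ext (pathEdges xs b) λ E → χ-cong
                  (λ (c , _) → c , []) (λ (c , _) → c , proj₂ (conn-endpoint c) ∷ []))
                (cycle-closing xs uq))
         (path-through-last xs uq) ⟩
  suc (triangular (length xs)) + suc (length xs)
    ≡⟨ cong suc (+-comm (triangular (length xs)) _) ⟩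
  suc (triangular (suc (length xs))) ∎
  where open ≡-Reasoning

-- Independence of the listing order, and rotation of the cycle

module _ {n : ℕ} where
  open PermSetoid (setoid (Fin n)) public using () renaming (_↭_ to _↭ᵥ_; ↭-sym to ↭ᵥ-sym; ↭-trans to ↭ᵥ-trans; ↭-reflexive to ↭ᵥ-reflexive; ↭-prep to ↭ᵥ-prep; ↭-refl to ↭ᵥ-refl)
  open PermSetoidProperties (setoid (Fin n)) public using () renaming (∈-resp-↭ to ∈-resp-↭ᵥ; ++-comm to ++ᵥ-comm; Unique-resp-↭ to Unique-resp-↭ᵥ; xs↭ys⇒|xs|≡|ys| to ↭ᵥ-length)
  open PermSetoid (undirected n) public using () renaming (_↭_ to _↭ₑ_; ↭-sym to ↭ₑ-sym; ↭-trans to ↭ₑ-trans; ↭-reflexive to ↭ₑ-reflexive; ↭-prep to ↭ₑ-prep; ↭-refl to ↭ₑ-refl)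
  open PermSetoidProperties (undirected n) public using () renaming (∈-resp-↭ to ∈-resp-↭ₑ; ++-comm to ++ₑ-comm)

spans-resp : ∀ {V′ : List (Fin n)} {E′} → V ↭ᵥ V′ → E ↭ₑ E′ → Spans U V E → Spans U V′ E′
spans-resp V↭ E↭ ((inside , r , r∈ , reach) , us) =
  ( (λ l → ∈-resp-↭ᵥ V↭ (inside (∈-resp-↭ₑ (↭ₑ-sym E↭) l)))
  , r , ∈-resp-↭ᵥ V↭ r∈
  , λ w∈ → kleisliStar id (λ l → ∈-resp-↭ₑ E↭ l ◅ ε) (reach (∈-resp-↭ᵥ (↭ᵥ-sym V↭) w∈)))
  , All.map (∈-resp-↭ᵥ V↭) us

subgraphs-resp : ∀ {L′ : List (Fin n)} {Es′} → L ↭ᵥ L′ → Es ↭ₑ Es′ → subgraphs U L Es ≡ subgraphs U L′ Es′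
subgraphs-resp {n} L↭ Es↭ = sublistSum-↭ refl sym L↭ λ V↭ →
  sublistSum-↭ (Setoid.refl (undirected n)) (Setoid.sym (undirected n)) Es↭ λ E↭ →
  χ-cong (spans-resp V↭ E↭) (spans-resp (↭ᵥ-sym V↭) (↭ₑ-sym E↭))

first-++ : ∀ (as : List A) u bs {b} → first (as ++ u ∷ bs) b ≡ first as u
first-++ []      u bs = refl
first-++ (_ ∷ _) u bs = refl

pathEdges-++ : ∀ (as : List A) u bs b → pathEdges (as ++ u ∷ bs) b ≡ pathEdges as u ++ pathEdges (u ∷ bs) b
pathEdges-++ []       u bs b = refl
pathEdges-++ (a ∷ as) u bs b = cong₂ _∷_ (cong (a ,_) (first-++ as u bs)) (pathEdges-++ as u bs b)

-- The cycle is counted only through its last vertex; making any chosen vertex the last one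
-- transfers the count to it.
cycle-rotate : ∀ xs → u ∈ xs ∷ʳ b →
  ∃ λ ys → length ys ≡ length xs × xs ∷ʳ b ↭ᵥ ys ∷ʳ u × cycleEdges xs b ↭ₑ cycleEdges ys u
cycle-rotate {u = u} {b} xs u∈ with ∈-++⁻ xs u∈
... | inj₂ (here refl) = xs , refl , ↭ᵥ-refl , ↭ₑ-refl
... | inj₁ q with ∈-∃++ q
...   | as , bs , refl = ys , length≡ , vertices , edges↭
  where
  ys = bs ++ b ∷ as
  length≡ : length (bs ++ b ∷ as) ≡ length (as ++ u ∷ bs)
  length≡ = begin
    length (bs ++ b ∷ as)       ≡⟨ length-++ bs ⟩
    length bs + suc (length as) ≡⟨ +-suc (length bs) _ ⟩
    suc (length bs + length as) ≡⟨ cong suc (+-comm (length bs) _) ⟩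
    suc (length as + length bs) ≡⟨ sym (+-suc (length as) _) ⟩
    length as + suc (length bs) ≡⟨ sym (length-++ as) ⟩
    length (as ++ u ∷ bs) ∎
    where open ≡-Reasoning
  regroup : ∀ (cs : List (Fin _)) c ds d → (cs ++ c ∷ ds) ∷ʳ d ≡ (cs ∷ʳ c) ++ (ds ∷ʳ d)
  regroup cs c ds d = trans (++-assoc cs (c ∷ ds) (d ∷ [])) (sym (++-assoc cs (c ∷ []) (ds ∷ʳ d)))
  vertices : (as ++ u ∷ bs) ∷ʳ b ↭ᵥ ys ∷ʳ u
  vertices = ↭ᵥ-trans (↭ᵥ-reflexive (regroup as u bs b))
    (↭ᵥ-trans (++ᵥ-comm (as ∷ʳ u) (bs ∷ʳ b)) (↭ᵥ-reflexive (sym (regroup bs b as u))))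
  split : ∀ (cs : List (Fin _)) c ds d →
    cycleEdges (cs ++ c ∷ ds) d ≡ ((first cs c , d) ∷ pathEdges cs c) ++ ((c , first ds d) ∷ pathEdges ds d)
  split cs c ds d = cong₂ _∷_ (cong (_, d) (first-++ cs c ds)) (pathEdges-++ cs c ds d)
  -- The old closing edge becomes a path edge and the edge leaving `u` becomes the closing edge.
  -- Both are traversed the other way, hence the two reversals around the exchange of the halves.
  edges↭ : cycleEdges (as ++ u ∷ bs) b ↭ₑ cycleEdges ys u
  edges↭ = ↭ₑ-trans (↭ₑ-reflexive (split as u bs b))
    (↭ₑ-trans (prep (inj₂ refl) ↭ₑ-refl)
    (↭ₑ-trans (++ₑ-comm ((b , first as u) ∷ pathEdges as u) ((u , first bs b) ∷ pathEdges bs b))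
    (↭ₑ-trans (prep (inj₂ refl) ↭ₑ-refl) (↭ₑ-reflexive (sym (split bs b as u))))))

-- Cycles with leaves attached one after another

-- The cycle has `suc k` vertices, its last one standing apart, and `m` leaves are attached. A new
-- leaf heads both lists, which is the form that `subgraphs-leaf` takes apart.
data Grown {n} (k : ℕ) : ℕ → List (Fin n) → List (Edge n) → Set where
  cycle : ∀ xs b → length xs ≡ k → Unique (xs ∷ʳ b) → Grown k 0 (xs ∷ʳ b) (cycleEdges xs b)
  leaf  : ∀ {m L Es v p} → Grown k m L Es → Fresh v L → p ∈ L → Grown k (suc m) (v ∷ L) ((v , p) ∷ Es)

-- The extremal configuration: `u` lies on the cycle and carries every leaf, so the grown graph is a
-- pineapple with centre `u`.
Hub : Grown {n} k m L Es → Fin n → Set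
Hub (cycle xs b _ _)     u = u ∈ xs ∷ʳ b
Hub (leaf {p = p} d _ _) u = p ≡ u × Hub d u

hub-∈ : (d : Grown {n} k m L Es) → Hub d u → u ∈ L
hub-∈ (cycle _ _ _ _) h       = h
hub-∈ (leaf d _ _)    (_ , h) = there (hub-∈ d h)

grown-avoids : Grown k m L Es → Fresh v L → Avoids v Es
grown-avoids (cycle xs b _ _) fr       = (fresh-first xs fr , fresh-last xs fr) ∷ avoids-path xs fr
grown-avoids (leaf d _ p∈)    (q ∷ fr) = (q , All.lookup fr p∈) ∷ grown-avoids d fr

-- With g = k + 1, a given vertex lies on j of the arcs with j vertices for each j from 1 to g,
-- where an arc with g vertices is the cycle minus an edge; the extra one is the cycle itself.
throughCycle : ℕ → ℕ
throughCycle k = suc (triangular (suc k))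

cycle-through : ∀ xs → Unique (xs ∷ʳ b) → u ∈ xs ∷ʳ b →
  subgraphs (u ∷ []) (xs ∷ʳ b) (cycleEdges xs b) ≡ throughCycle (length xs)
cycle-through xs uq u∈ with cycle-rotate xs u∈
... | ys , len , L↭ , Es↭ = trans (subgraphs-resp L↭ Es↭)
  (trans (cycle-through-last ys (Unique-resp-↭ᵥ L↭ uq)) (cong throughCycle len))

subgraphs-∷-≤ : ∀ (p : Fin n) U L Es → subgraphs (p ∷ U) L Es ≤ subgraphs U L Es
subgraphs-∷-≤ p U L Es = sublistSum-mono L λ V → sublistSum-mono Es λ E → χ-mono λ { (c , _ ∷ us) → c , us }

-- The subgraph with the single vertex `u` contains `u` and misses `p`.
subgraphs-∷-< : u ∈ L → p ≢ u → subgraphs (p ∷ u ∷ []) L Es < subgraphs (u ∷ []) L Es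
subgraphs-∷-< {u = u} {p = p} {Es = Es} u∈ p≢u = sublistSum-mono-<
  (λ V → sublistSum-mono Es λ E → drop-p) u∈
  (sublistSum-mono-<-[] Es (λ E → drop-p) (subst₂ _<_
    (sym (χ-0 λ { (_ , here refl ∷ _) → p≢u refl })) (sym (χ-1 (conn-single , here refl ∷ []))) (s≤s z≤n)))
  where
  drop-p : ∀ {V E} → χ (p ∷ u ∷ []) V E ≤ χ (u ∷ []) V E
  drop-p = χ-mono λ { (c , _ ∷ us) → c , us }

subgraphs-∷-dup : ∀ (u : Fin n) L Es → subgraphs (u ∷ u ∷ []) L Es ≡ subgraphs (u ∷ []) L Es
subgraphs-∷-dup u L Es = sublistSum-ext L λ V → sublistSum-ext Es λ E →
  χ-cong (λ { (c , _ ∷ us) → c , us }) (λ { (c , q ∷ us) → c , q ∷ q ∷ us })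

module _ (d : Grown {n} k m L Es) (fr : Fresh v L) (p∈ : p ∈ L) where

  private
    v≢p : v ≢ p
    v≢p = All.lookup fr p∈

  leaf-through-old : u ∈ L → subgraphs (u ∷ []) (v ∷ L) ((v , p) ∷ Es)
    ≡ subgraphs (p ∷ u ∷ []) L Es + subgraphs (u ∷ []) L Es
  leaf-through-old {u = u} u∈ = trans (subgraphs-leaf fr (grown-avoids d fr) v≢p (All.lookup fr u∈ ∷ []))
    (cong (_+ subgraphs (u ∷ []) L Es) (+-identityʳ _))

  leaf-through-new : subgraphs (v ∷ []) (v ∷ L) ((v , p) ∷ Es) ≡ subgraphs (p ∷ []) L Es + 1
  leaf-through-new = subgraphs-leaf-self fr (grown-avoids d fr) v≢p []

  leaf-total : subgraphs [] (v ∷ L) ((v , p) ∷ Es) ≡ (subgraphs (p ∷ []) L Es + 1) + subgraphs [] L Es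
  leaf-total = subgraphs-leaf fr (grown-avoids d fr) v≢p []

double : ∀ m k → 2 ^ suc m * throughCycle k ≡ 2 ^ m * throughCycle k + 2 ^ m * throughCycle k
double m k = trans (*-assoc 2 (2 ^ m) _) (cong (2 ^ m * throughCycle k +_) (+-identityʳ _))

1<power : ∀ m k → 1 < 2 ^ m * throughCycle k
1<power m k = *-mono-≤ (m^n>0 2 m) (s≤s (s≤s z≤n))

mutual
  through-≤ : (d : Grown {n} k m L Es) → u ∈ L → subgraphs (u ∷ []) L Es ≤ 2 ^ m * throughCycle k
  through-≤ (cycle xs b refl uq) u∈ = ≤-reflexive (trans (cycle-through xs uq u∈) (sym (*-identityˡ _)))
  through-≤ (leaf d fr p∈) (here refl) = <⇒≤ (through-new-< d fr p∈)
  through-≤ {k = k} {suc m} {u = u} (leaf {L = L} {Es} {v} {p} d fr p∈) (there u∈) = begin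
    subgraphs (u ∷ []) (v ∷ L) ((v , p) ∷ Es)
      ≡⟨ leaf-through-old d fr p∈ u∈ ⟩
    subgraphs (p ∷ u ∷ []) L Es + subgraphs (u ∷ []) L Es
      ≤⟨ +-monoˡ-≤ (subgraphs (u ∷ []) L Es) (subgraphs-∷-≤ p (u ∷ []) L Es) ⟩
    subgraphs (u ∷ []) L Es + subgraphs (u ∷ []) L Es
      ≤⟨ +-mono-≤ (through-≤ d u∈) (through-≤ d u∈) ⟩
    2 ^ m * throughCycle k + 2 ^ m * throughCycle k
      ≡⟨ sym (double m k) ⟩
    2 ^ suc m * throughCycle k ∎
    where open ≤-Reasoning

  -- With P the earlier maximum, a new leaf gets at most P + 1, which is below 2P because P > 1. So
  -- no vertex off the cycle is ever extremal.
  through-new-< : (d : Grown {n} k m L Es) (fr : Fresh v L) (p∈ : p ∈ L) →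
    subgraphs (v ∷ []) (v ∷ L) ((v , p) ∷ Es) < 2 ^ suc m * throughCycle k
  through-new-< {k = k} {m} {L} {Es} {v} {p} d fr p∈ = begin-strict
    subgraphs (v ∷ []) (v ∷ L) ((v , p) ∷ Es) ≡⟨ leaf-through-new d fr p∈ ⟩
    subgraphs (p ∷ []) L Es + 1               ≤⟨ +-monoˡ-≤ 1 (through-≤ d p∈) ⟩
    2 ^ m * throughCycle k + 1                <⟨ +-monoʳ-< (2 ^ m * throughCycle k) (1<power m k) ⟩
    2 ^ m * throughCycle k + 2 ^ m * throughCycle k ≡⟨ sym (double m k) ⟩
    2 ^ suc m * throughCycle k ∎
    where open ≤-Reasoning

through-hub : (d : Grown {n} k m L Es) → Hub d u → subgraphs (u ∷ []) L Es ≡ 2 ^ m * throughCycle k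
through-hub (cycle xs b refl uq) h = trans (cycle-through xs uq h) (sym (*-identityˡ _))
through-hub {k = k} {suc m} {u = u} (leaf {L = L} {Es} {v} d fr p∈) (refl , h) = begin
  subgraphs (u ∷ []) (v ∷ L) ((v , u) ∷ Es)             ≡⟨ leaf-through-old d fr p∈ (hub-∈ d h) ⟩
  subgraphs (u ∷ u ∷ []) L Es + subgraphs (u ∷ []) L Es ≡⟨ cong (_+ subgraphs (u ∷ []) L Es) (subgraphs-∷-dup u L Es) ⟩
  subgraphs (u ∷ []) L Es + subgraphs (u ∷ []) L Es     ≡⟨ cong₂ _+_ (through-hub d h) (through-hub d h) ⟩
  2 ^ m * throughCycle k + 2 ^ m * throughCycle k       ≡⟨ sym (double m k) ⟩
  2 ^ suc m * throughCycle k ∎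
  where open ≡-Reasoning

≤-+-≡ : ∀ {a b c d} → a ≤ c → b ≤ d → a + b ≡ c + d → a ≡ c × b ≡ d
≤-+-≡ {a} {b} {c} {d} a≤c b≤d eq with m≤n⇒m<n∨m≡n a≤c
... | inj₁ a<c  = contradiction eq (<⇒≢ (+-mono-<-≤ a<c b≤d))
... | inj₂ refl = refl , +-cancelˡ-≡ a b d eq

-- Doubling splits into two summands with the same upper bound, so both attain it. The first then
-- equals the count through `u` alone, which forces the leaf to hang at `u`; the second feeds the
-- induction.
through-≡⇒hub : (d : Grown {n} k m L Es) → u ∈ L → subgraphs (u ∷ []) L Es ≡ 2 ^ m * throughCycle k → Hub d u
through-≡⇒hub (cycle xs b _ _) u∈ _ = u∈
through-≡⇒hub (leaf d fr p∈) (here refl) eq = contradiction eq (<⇒≢ (through-new-< d fr p∈))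
through-≡⇒hub {k = k} {suc m} {u = u} (leaf {L = L} {Es} {p = p} d fr p∈) (there u∈) eq
  with ≤-+-≡ (≤-trans (subgraphs-∷-≤ p (u ∷ []) L Es) (through-≤ d u∈)) (through-≤ d u∈)
             (trans (sym (leaf-through-old d fr p∈ u∈)) (trans eq (double m k)))
... | eq₁ , eq₂ with p ≟ᶠ u
...   | yes p≡u = p≡u , through-≡⇒hub d u∈ eq₂
...   | no p≢u  = contradiction (trans eq₁ (sym eq₂)) (<⇒≢ (subgraphs-∷-< {Es = Es} u∈ p≢u))

-- The first summand counts the subgraphs with the closing edge, the second those without it.
-- Together they make g^2 + 1 for g = k + 1.
cycleTotal : ℕ → ℕ
cycleTotal k = suc (triangular k) + triangular (suc k)

rearrange : ∀ P K m → (P + 1) + ((K + m) + P) ≡ (K + suc m) + (P + P)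
rearrange = solve-∀

-- throughCycle is added on the left to avoid subtracting it on the right.
total-≤ : (d : Grown {n} k m L Es) → subgraphs [] L Es + throughCycle k ≤ (cycleTotal k + m) + 2 ^ m * throughCycle k
total-≤ {k = k} (cycle xs b refl uq) = ≤-reflexive
  (cong₂ _+_ (trans (cycle-total xs uq) (sym (+-identityʳ _))) (sym (*-identityˡ _)))
total-≤ {k = k} {suc m} (leaf {L = L} {Es} {v} {p} d fr p∈) = begin
  subgraphs [] (v ∷ L) ((v , p) ∷ Es) + throughCycle k
    ≡⟨ cong (_+ throughCycle k) (leaf-total d fr p∈) ⟩
  ((subgraphs (p ∷ []) L Es + 1) + subgraphs [] L Es) + throughCycle k
    ≡⟨ +-assoc (subgraphs (p ∷ []) L Es + 1) _ _ ⟩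
  (subgraphs (p ∷ []) L Es + 1) + (subgraphs [] L Es + throughCycle k)
    ≤⟨ +-mono-≤ (+-monoˡ-≤ 1 (through-≤ d p∈)) (total-≤ d) ⟩
  (P + 1) + ((cycleTotal k + m) + P)
    ≡⟨ rearrange P (cycleTotal k) m ⟩
  (cycleTotal k + suc m) + (P + P)
    ≡⟨ cong ((cycleTotal k + suc m) +_) (sym (double m k)) ⟩
  (cycleTotal k + suc m) + 2 ^ suc m * throughCycle k ∎
  where
  open ≤-Reasoning
  P = 2 ^ m * throughCycle k

total-hub : (d : Grown {n} k m L Es) → Hub d u →
  subgraphs [] L Es + throughCycle k ≡ (cycleTotal k + m) + 2 ^ m * throughCycle k
total-hub (cycle xs b refl uq) h =
  cong₂ _+_ (trans (cycle-total xs uq) (sym (+-identityʳ _))) (sym (*-identityˡ _))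
total-hub {k = k} {suc m} (leaf {L = L} {Es} {v} {p} d fr p∈) (refl , h) = begin
  subgraphs [] (v ∷ L) ((v , p) ∷ Es) + throughCycle k
    ≡⟨ cong (_+ throughCycle k) (leaf-total d fr p∈) ⟩
  ((subgraphs (p ∷ []) L Es + 1) + subgraphs [] L Es) + throughCycle k
    ≡⟨ +-assoc (subgraphs (p ∷ []) L Es + 1) _ _ ⟩
  (subgraphs (p ∷ []) L Es + 1) + (subgraphs [] L Es + throughCycle k)
    ≡⟨ cong₂ _+_ (cong (_+ 1) (through-hub d h)) (total-hub d h) ⟩
  (P + 1) + ((cycleTotal k + m) + P)
    ≡⟨ rearrange P (cycleTotal k) m ⟩
  (cycleTotal k + suc m) + (P + P)
    ≡⟨ cong ((cycleTotal k + suc m) +_) (sym (double m k)) ⟩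
  (cycleTotal k + suc m) + 2 ^ suc m * throughCycle k ∎
  where
  open ≡-Reasoning
  P = 2 ^ m * throughCycle k

-- The index `suc m` supplies a last leaf, whose neighbour `p` is the hub. The total is the count
-- through `p`, plus one, plus the earlier total; as both counts are bounded, the one through `p`
-- has to be maximal.
total-≡⇒hub : (d : Grown {n} k (suc m) L Es) →
  subgraphs [] L Es + throughCycle k ≡ (cycleTotal k + suc m) + 2 ^ suc m * throughCycle k → ∃ (Hub d)
total-≡⇒hub {k = k} {m} (leaf {L = L} {Es} {v} {p} d fr p∈) eq = p , refl , through-≡⇒hub d p∈
  (+-cancelʳ-≡ 1 _ _ (proj₁ (≤-+-≡ (+-monoˡ-≤ 1 (through-≤ d p∈)) (total-≤ d) (begin
    (subgraphs (p ∷ []) L Es + 1) + (subgraphs [] L Es + throughCycle k)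
      ≡⟨ sym (+-assoc (subgraphs (p ∷ []) L Es + 1) _ _) ⟩
    ((subgraphs (p ∷ []) L Es + 1) + subgraphs [] L Es) + throughCycle k
      ≡⟨ cong (_+ throughCycle k) (sym (leaf-total d fr p∈)) ⟩
    subgraphs [] (v ∷ L) ((v , p) ∷ Es) + throughCycle k
      ≡⟨ eq ⟩
    (cycleTotal k + suc m) + 2 ^ suc m * throughCycle k
      ≡⟨ cong ((cycleTotal k + suc m) +_) (double m k) ⟩
    (cycleTotal k + suc m) + (P + P)
      ≡⟨ sym (rearrange P (cycleTotal k) m) ⟩
    (P + 1) + ((cycleTotal k + m) + P) ∎))))
  where
  open ≡-Reasoning
  P = 2 ^ m * throughCycle k

-- From a connected graph with a cycle to its construction by leaves

Within : Graph n → List (Edge n) → Set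
Within G = All λ (a , b) → G a b ≡ true

T⇒≡ : ∀ {x} → T x → x ≡ true
T⇒≡ {true} _ = refl

≡⇒T : ∀ {x} → x ≡ true → T x
≡⇒T refl = tt

module _ (G : Graph n) where

  private
    forward? : ∀ i j → Dec (((toℕ i <ᵇ toℕ j) ∧ G i j) ≡ true)
    forward? i j = ((toℕ i <ᵇ toℕ j) ∧ G i j) Bool.≟ true

    row : Fin n → List (Edge n)
    row i = map (i ,_) (filter (forward? i) (allFin n))

  edges-∈ : ∀ {i j} → toℕ i < toℕ j → G i j ≡ true → (i , j) ∈ edges G
  edges-∈ {i} {j} i<j e = ∈-concatMap⁺ row (Any.map (λ { refl → ∈-map⁺ (i ,_)
    (∈-filter⁺ (forward? i) (∈-allFin j) (cong₂ _∧_ (T⇒≡ (<⇒<ᵇ i<j)) e)) }) (∈-allFin i))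

  edges-∈⁻ : ∀ {e} → e ∈ edges G → toℕ (proj₁ e) < toℕ (proj₂ e) × G (proj₁ e) (proj₂ e) ≡ true
  edges-∈⁻ e∈ with Any.satisfied (∈-concatMap⁻ row {xs = allFin n} e∈)
  ... | i , q with ∈-map⁻ (i ,_) q
  ...   | j , j∈ , refl with ∧-true {toℕ i <ᵇ toℕ j} (proj₂ (∈-filter⁻ (forward? i) {xs = allFin n} j∈))
  ...     | i<j , g = <ᵇ⇒< (toℕ i) (toℕ j) (≡⇒T i<j) , g

  -- Every edge is listed with its smaller endpoint first, so no entry is the reversal of another
  -- and plain distinctness suffices.
  edges-unique : UniqueSetoid.Unique (undirected n) (edges G)
  edges-unique = upgrade (All.tabulate (proj₁ ∘ edges-∈⁻)) (concat⁺
    (All-map⁺ (All.tabulate λ {i} _ → Unique-map⁺ (cong proj₂) (filter⁺ (forward? i) (allFin⁺ n))))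
    (AllPairs.map⁺ (AllPairs.map disjoint (allFin⁺ n))))
    where
    disjoint : ∀ {i j} → i ≢ j → ∀ {e} → ¬ (e ∈ row i × e ∈ row j)
    disjoint {i} {j} i≢j (p , q) with ∈-map⁻ (i ,_) p | ∈-map⁻ (j ,_) q
    ... | _ , _ , refl | _ , _ , refl = i≢j refl
    upgrade : ∀ {es : List (Edge n)} → All (λ (a , b) → toℕ a < toℕ b) es → Unique es →
      UniqueSetoid.Unique (undirected n) es
    upgrade []         []         = []
    upgrade (lt ∷ lts) (ne ∷ uq) = All.zipWith
      (λ { (ne , lt′) (inj₁ eq) → ne eq ; (ne , lt′) (inj₂ refl) → <-asym lt lt′ }) (ne , lts) ∷ upgrade lts uq

  module _ (simple : Simple G) where

    within-link : ∀ {a b} → Within G Es → Link Es a b → G a b ≡ true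
    within-link within l with link⇒∈ l
    ... | inj₁ q = All.lookup within q
    ... | inj₂ q = trans (proj₁ simple _ _) (All.lookup within q)

    edges-within : Within G (edges G)
    edges-within = All.tabulate (proj₂ ∘ edges-∈⁻)

    edges-link : ∀ {a b} → G a b ≡ true → Link (edges G) a b
    edges-link {a} {b} e with <-cmp (toℕ a) (toℕ b)
    ... | tri< a<b _ _ = ∈⇒link (edges-∈ a<b e)
    ... | tri> _ _ b<a = link-sym (∈⇒link (edges-∈ b<a (trans (proj₁ simple b a) e)))
    ... | tri≈ _ a≡b _ with toℕ-injective a≡b
    ...   | refl = contradiction (trans (sym e) (proj₂ simple a)) λ ()

grown-unique : Grown {n} k m L Es → Unique L
grown-unique (cycle _ _ _ uq) = uq
grown-unique (leaf d fr _)    = fr ∷ grown-unique d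

grown-length : Grown {n} k m L Es → length L ≡ m + suc k
grown-length (cycle xs b refl _) = trans (length-++ xs) (+-comm (length xs) 1)
grown-length (leaf d _ _)        = cong suc (grown-length d)

grown-length-edges : Grown {n} k m L Es → length Es ≡ m + suc k
grown-length-edges (cycle xs b refl _) = cong suc (path-length xs)
  where
  path-length : ∀ (xs : List A) {b} → length (pathEdges xs b) ≡ length xs
  path-length []       = refl
  path-length (x ∷ xs) = cong suc (path-length xs)
grown-length-edges (leaf d _ _) = cong suc (grown-length-edges d)

avoids-distinct : Avoids v E → All (λ e → ¬ Setoid._≈_ (undirected n) (v , p) e) E
avoids-distinct = All.map λ { (v≢a , v≢b) (inj₁ refl) → v≢a refl ; (v≢a , v≢b) (inj₂ refl) → v≢b refl }

path-edges-unique : ∀ xs → Unique (xs ∷ʳ b) → UniqueSetoid.Unique (undirected n) (pathEdges xs b)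
path-edges-unique []       _         = []
path-edges-unique (x ∷ xs) (fr ∷ uq) = avoids-distinct (avoids-path xs fr) ∷ path-edges-unique xs uq

-- The bound on `k` asks for at least three vertices on the cycle: with two, the closing edge would
-- repeat the only path edge.
grown-edges-unique : 2 ≤ k → Grown {n} k m L Es → UniqueSetoid.Unique (undirected n) Es
grown-edges-unique 2≤k (leaf d fr p∈) = avoids-distinct (grown-avoids d fr) ∷ grown-edges-unique 2≤k d
grown-edges-unique () (cycle [] b refl uq)
grown-edges-unique (s≤s ()) (cycle (x ∷ []) b refl uq)
grown-edges-unique 2≤k (cycle (x ∷ x′ ∷ xs) b refl uq@((x≢x′ ∷ fr) ∷ fr′ ∷ _)) =
  ((λ { (inj₁ refl) → fresh-last xs fr′ refl ; (inj₂ refl) → x≢x′ refl })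
    ∷ avoids-distinct (avoids-path (x′ ∷ xs) (x≢x′ ∷ fr)))
  ∷ path-edges-unique (x ∷ x′ ∷ xs) uq

spanning-vertices : Grown {n} k m L Es → m + suc k ≡ n → allFin n ↭ᵥ L
spanning-vertices {n} d eq = unique-⊆⇒↭ (grown-unique d) (λ {x} _ → ∈-allFin x)
  (≤-reflexive (trans (length-tabulate id) (trans (sym eq) (sym (grown-length d)))))
  where open UniqueRearrangement (setoid (Fin n))

missing-vertex : ∀ {L : List (Fin n)} → length L < n → ∃ λ w → w ∉ L
missing-vertex {n} {L} L<n with any? (λ w → ¬? (_∈?_ _≟ᶠ_ w L))
... | yes w = w
... | no ¬w = contradiction L<n (≤⇒≯ (subst (_≤ length L) (length-tabulate id)
    (unique-⊆⇒length≤ (allFin⁺ n) (λ {x} _ → in-L x))))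
  where
  open UniqueRearrangement (setoid (Fin n))
  in-L : ∀ w → w ∈ L
  in-L w with _∈?_ _≟ᶠ_ w L
  ... | yes w∈ = w∈
  ... | no w∉  = contradiction (w , w∉) ¬w

some-vertex : Grown {n} k m L Es → ∃ (_∈ L)
some-vertex (cycle xs b _ _) = b , ∈-++⁺ʳ xs (here refl)
some-vertex (leaf _ _ _)     = _ , here refl

module _ (G : Graph n) (simple : Simple G) where

  -- The construction yields `m + suc k` distinct edges of `G`, and `G` has no more than that, so
  -- there are no others.
  spanning-edges : 2 ≤ k → Grown {n} k m L Es → Within G Es → length (edges G) ≤ m + suc k → edges G ↭ₑ Es
  spanning-edges 2≤k d within len≤ = unique-⊆⇒↭ (grown-edges-unique 2≤k d)
    (edges-link G simple ∘ within-link G simple within)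
    (subst (length (edges G) ≤_) (sym (grown-length-edges d)) len≤)
    where open UniqueRearrangement (undirected n)

  F-grown : 2 ≤ k → (d : Grown {n} k m L Es) → Within G Es → m + suc k ≡ n → length (edges G) ≤ n →
    F G ≡ subgraphs [] L Es
  F-grown 2≤k d within eq len≤ = trans (F-subgraphs G)
    (subgraphs-resp (spanning-vertices d eq) (spanning-edges 2≤k d within (subst (length (edges G) ≤_) (sym eq) len≤)))

  reach-exit : ∀ {L : List (Fin n)} {i j} → Reach G i j → i ∈ L → j ∉ L → ∃₂ λ a b → a ∈ L × b ∉ L × G a b ≡ true
  reach-exit here i∈ j∉ = contradiction i∈ j∉
  reach-exit {L = L} (step {i} {j} e r) i∈ k∉ with _∈?_ _≟ᶠ_ j L
  ... | yes j∈ = reach-exit r j∈ k∉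
  ... | no j∉  = i , j , i∈ , j∉ , e

  -- Here `r` is the number of vertices still missing. A walk to a missing vertex leaves `L` along
  -- some edge, which attaches its outer end as a leaf. Further edges between the same parts are not
  -- examined here; counting edges excludes them later.
  grow : Connected G → ∀ r → Grown {n} k m L Es → Within G Es → r + (m + suc k) ≡ n →
    ∃₂ λ L′ Es′ → Grown k (r + m) L′ Es′ × Within G Es′
  grow conn zero d within eq = _ , _ , d , within
  grow {k = k} {m} {L} conn (suc r) d within eq
    with some-vertex d | missing-vertex (subst₂ _<_ (sym (grown-length d)) eq (s≤s (m≤n+m (m + suc k) r)))
  ... | i , i∈ | w , w∉ with reach-exit (conn i w) i∈ w∉
  ...   | a , v , a∈ , v∉ , e
    with grow conn r (leaf d (¬Any⇒All¬ L v∉) a∈) (trans (proj₁ simple v a) e ∷ within)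
           (trans (+-suc r (m + suc k)) eq)
  ...     | L′ , Es′ , d′ , within′ = L′ , Es′ , subst (λ q → Grown k q L′ Es′) (+-suc r m) d′ , within′

  path-within : ∀ q (h : Fin (suc q) → Fin n) {b} → (∀ i → G (h (inject₁ i)) (h (suc i)) ≡ true) →
    G (h (fromℕ q)) b ≡ true → Within G (pathEdges (tabulate h) b)
  path-within zero    h steps close = close ∷ []
  path-within (suc q) h steps close = steps zero ∷ path-within q (h ∘ suc) (steps ∘ suc) close

  girth-cycle : HasCycleOfLength G (suc k) → 2 ≤ k × ∃₂ λ L Es → Grown {n} k 0 L Es × Within G Es
  girth-cycle {k = suc (suc q)} (f , inj , steps , close) = s≤s (s≤s z≤n) ,
    -- `f zero` is taken as the last vertex. Its edge to the next vertex thus becomes the closing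
    -- edge, reversed, and the edge that closed the given cycle ends the path.
    _ , _ , cycle (tabulate (f ∘ suc)) (f zero) (length-tabulate (f ∘ suc)) unique ,
    trans (proj₁ simple _ _) (steps zero) ∷ path-within (suc q) (f ∘ suc) (steps ∘ suc) close
    where
    unique : Unique (tabulate (f ∘ suc) ∷ʳ f zero)
    unique = Unique-resp-↭ᵥ (PermSetoidProperties.∷↭∷ʳ (setoid (Fin n)) (f zero) (tabulate (f ∘ suc)))
      (Unique-tabulate⁺ {f = f} inj)

-- Pineapples

-- Polymorphic in the vertices, so that the same list can be read on numbers, where pineapple
-- adjacency is arithmetic.
pineEdges : List A → A → List A → List (A × A)
pineEdges xs b D = map (_, b) D ++ cycleEdges xs b

pine-grown : ∀ {xs} {b : Fin n} D → Unique (D ++ xs ∷ʳ b) →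
  Σ (Grown (length xs) (length D) (D ++ xs ∷ʳ b) (pineEdges xs b D)) λ d → Hub d b
pine-grown {xs = xs} {b} []      uq        = cycle xs b refl uq , ∈-++⁺ʳ xs (here refl)
pine-grown {xs = xs} {b} (v ∷ D) (fr ∷ uq) with pine-grown D uq
... | d , h = leaf d fr (hub-∈ d h) , refl , h

-- The cycle is rotated until the hub is its last vertex; every leaf then contributes exactly one
-- pendant edge at that vertex.
hub⇒pine : (d : Grown {n} k m L Es) → Hub d u →
  ∃₂ λ xs D → length xs ≡ k × L ↭ᵥ D ++ xs ∷ʳ u × Es ↭ₑ pineEdges xs u D
hub⇒pine (cycle xs b len _) h with cycle-rotate xs h
... | ys , len′ , L↭ , Es↭ = ys , [] , trans len′ len , L↭ , Es↭
hub⇒pine (leaf {v = v} d _ _) (refl , h) with hub⇒pine d h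
... | xs , D , len , L↭ , Es↭ = xs , v ∷ D , len , ↭ᵥ-prep v L↭ , ↭ₑ-prep (v , _) Es↭

pineEdges-map : ∀ (h : A → B) xs b D →
  pineEdges (map h xs) (h b) (map h D) ≡ map (Product.map h h) (pineEdges xs b D)
pineEdges-map h xs b D = begin
  map (_, h b) (map h D) ++ cycleEdges (map h xs) (h b)
    ≡⟨ cong₂ _++_ (trans (sym (map-∘ D)) (map-∘ D)) (cong₂ _∷_ (cong (_, h b) (first-map xs)) (path-map xs)) ⟩
  map (Product.map h h) (map (_, b) D) ++ map (Product.map h h) (cycleEdges xs b)
    ≡⟨ sym (map-++ (Product.map h h) (map (_, b) D) (cycleEdges xs b)) ⟩
  map (Product.map h h) (pineEdges xs b D) ∎
  where
  open ≡-Reasoning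
  first-map : ∀ xs → first (map h xs) (h b) ≡ h (first xs b)
  first-map []      = refl
  first-map (_ ∷ _) = refl
  path-map : ∀ xs → pathEdges (map h xs) (h b) ≡ map (Product.map h h) (pathEdges xs b)
  path-map []       = refl
  path-map (x ∷ xs) = cong₂ _∷_ (cong (h x ,_) (first-map xs)) (path-map xs)

∈-map-injective : ∀ {h : A → B} → Injective _≡_ _≡_ h → ∀ {a c E} →
  (h a , h c) ∈ map (Product.map h h) E → (a , c) ∈ E
∈-map-injective inj q with ∈-map⁻ _ q
... | (a′ , c′) , e∈ , eq with inj (cong proj₁ eq) | inj (cong proj₂ eq)
...   | refl | refl = e∈

-- Pineapple adjacency on vertex numbers

upFrom : ℕ → ℕ → List ℕ
upFrom s zero    = []
upFrom s (suc m) = s ∷ upFrom (suc s) m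

take-upFrom : ∀ s {k m} → k ≤ m → take k (upFrom s m) ≡ upFrom s k
take-upFrom s z≤n       = refl
take-upFrom s (s≤s k≤m) = cong (s ∷_) (take-upFrom (suc s) k≤m)

drop-upFrom : ∀ s k m → drop k (upFrom s m) ≡ upFrom (k + s) (m ∸ k)
drop-upFrom s zero    m       = refl
drop-upFrom s (suc k) zero    = refl
drop-upFrom s (suc k) (suc m) = trans (drop-upFrom (suc s) k m) (cong (λ t → upFrom t (m ∸ k)) (+-suc k s))

toℕ-tabulate : ∀ m s (h : Fin m → Fin n) → (∀ i → toℕ (h i) ≡ s + toℕ i) → map toℕ (tabulate h) ≡ upFrom s m
toℕ-tabulate zero    s h eq = refl
toℕ-tabulate (suc m) s h eq = cong₂ _∷_ (trans (eq zero) (+-identityʳ s))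
  (toℕ-tabulate m (suc s) (h ∘ suc) (λ i → trans (eq (suc i)) (+-suc s (toℕ i))))

∈-upFrom⁻ : ∀ {a} s m → a ∈ upFrom s m → s ≤ a
∈-upFrom⁻ s (suc m) (here refl) = ≤-refl
∈-upFrom⁻ s (suc m) (there q)   = <⇒≤ (∈-upFrom⁻ (suc s) m q)

∈-upFrom⁺ : ∀ {a} s m → s ≤ a → a < s + m → a ∈ upFrom s m
∈-upFrom⁺ s zero    s≤a a< = contradiction (<-≤-trans a< (≤-reflexive (+-identityʳ s))) (≤⇒≯ s≤a)
∈-upFrom⁺ {a} s (suc m) s≤a a< with m≤n⇒m<n∨m≡n s≤a
... | inj₂ refl = here refl
... | inj₁ s<a  = there (∈-upFrom⁺ (suc s) m s<a (subst (a <_) (+-suc s m) a<))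

path-upFrom⁻ : ∀ {a c} s k → (a , c) ∈ pathEdges (upFrom s k) 0 →
  s ≤ a × (c ≡ suc a × suc a < s + k ⊎ c ≡ 0 × suc a ≡ s + k)
path-upFrom⁻ s (suc zero)    (here refl) = ≤-refl , inj₂ (refl , sym (+-comm s 1))
path-upFrom⁻ s (suc (suc k)) (here refl) = ≤-refl , inj₁ (refl , subst (suc s <_) (sym (+-suc s (suc k)))
  (s≤s (subst (suc s ≤_) (sym (+-suc s k)) (s≤s (m≤m+n s k)))))
path-upFrom⁻ s (suc k)       (there q) with path-upFrom⁻ (suc s) k q
... | s<a , r rewrite +-suc s k = <⇒≤ s<a , r

path-upFrom-step : ∀ {a} s k → s ≤ a → suc a < s + k → (a , suc a) ∈ pathEdges (upFrom s k) 0
path-upFrom-step s zero s≤a a< = contradiction (<⇒≤ (<-≤-trans a< (≤-reflexive (+-identityʳ s)))) (≤⇒≯ s≤a)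
path-upFrom-step {a} s (suc k) s≤a a< with m≤n⇒m<n∨m≡n s≤a
path-upFrom-step s (suc zero)    s≤a a< | inj₂ refl = contradiction a< (≤⇒≯ (≤-reflexive (+-comm s 1)))
path-upFrom-step s (suc (suc k)) s≤a a< | inj₂ refl = here refl
path-upFrom-step {a} s (suc k)   s≤a a< | inj₁ s<a  =
  there (path-upFrom-step (suc s) k s<a (subst (suc a <_) (+-suc s k) a<))

path-upFrom-last : ∀ s k → (s + k , 0) ∈ pathEdges (upFrom s (suc k)) 0
path-upFrom-last s zero rewrite +-identityʳ s = here refl
path-upFrom-last s (suc k) = there (subst (λ t → (t , 0) ∈ pathEdges (upFrom (suc s) (suc k)) 0) (sym (+-suc s k))
  (path-upFrom-last (suc s) k))

Adjacent : ℕ → ℕ → ℕ → Set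
Adjacent g a c = (c ≡ suc a × c < g) ⊎ (a ≡ 0 × suc c ≡ g) ⊎ (a ≡ 0 × g ≤ c)

≡ᵇ-true : ∀ {a c} → a ≡ c → (a ≡ᵇ c) ≡ true
≡ᵇ-true {a} {c} eq = T⇒≡ (≡⇒≡ᵇ a c eq)

≡ᵇ-true⁻ : ∀ {a c} → (a ≡ᵇ c) ≡ true → a ≡ c
≡ᵇ-true⁻ {a} {c} h = ≡ᵇ⇒≡ a c (≡⇒T h)

pineAdj₀-true : ∀ {g a c} → Adjacent g a c → pineAdj₀ g a c ≡ true
pineAdj₀-true {g} {a} {c} (inj₁ (eq , lt)) = ∨-true₁ (cong₂ _∧_ (≡ᵇ-true eq) (T⇒≡ (<⇒<ᵇ lt)))
pineAdj₀-true {g} {a} {c} (inj₂ (inj₁ (refl , eq))) =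
  ∨-true₂ {(c ≡ᵇ suc a) ∧ (c <ᵇ g)} (∨-true₁ (≡ᵇ-true eq))
pineAdj₀-true {g} {a} {c} (inj₂ (inj₂ (refl , le))) =
  ∨-true₂ {(c ≡ᵇ suc a) ∧ (c <ᵇ g)} (∨-true₂ {suc c ≡ᵇ g} not-lt)
  where
  not-lt : not (c <ᵇ g) ≡ true
  not-lt with c <ᵇ g in eq
  ... | false = refl
  ... | true  = contradiction (<ᵇ⇒< c g (≡⇒T eq)) (≤⇒≯ le)

pineAdj₀-true⁻ : ∀ {g a c} → pineAdj₀ g a c ≡ true → Adjacent g a c
pineAdj₀-true⁻ {g} {a} {c} h with ∨-true {(c ≡ᵇ suc a) ∧ (c <ᵇ g)} h
... | inj₁ q with ∧-true {c ≡ᵇ suc a} q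
...   | q₁ , q₂ = inj₁ (≡ᵇ-true⁻ q₁ , <ᵇ⇒< c g (≡⇒T q₂))
pineAdj₀-true⁻ {g} {a} {c} h | inj₂ q with ∨-true {(a ≡ᵇ 0) ∧ (suc c ≡ᵇ g)} q
... | inj₁ r with ∧-true {a ≡ᵇ 0} r
...   | r₁ , r₂ = inj₂ (inj₁ (≡ᵇ-true⁻ r₁ , ≡ᵇ-true⁻ r₂))
pineAdj₀-true⁻ {g} {a} {c} h | inj₂ q | inj₂ r with ∧-true {a ≡ᵇ 0} r
...   | r₁ , r₂ = inj₂ (inj₂ (≡ᵇ-true⁻ r₁ , ≮⇒≥ λ lt → contradiction (trans (sym r₂) (cong not (T⇒≡ (<⇒<ᵇ lt)))) λ ()))

≢ᵇ-true : ∀ {a c} → a ≢ c → not (a ≡ᵇ c) ≡ true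
≢ᵇ-true {a} {c} a≢c with a ≡ᵇ c in eq
... | false = refl
... | true  = contradiction (≡ᵇ-true⁻ eq) a≢c

pineapple-adjacent : ∀ g (i j : Fin n) → toℕ i ≢ toℕ j →
  Adjacent g (toℕ i) (toℕ j) ⊎ Adjacent g (toℕ j) (toℕ i) → pineapple n g i j ≡ true
pineapple-adjacent g i j ne (inj₁ adj) = cong₂ _∧_ (≢ᵇ-true ne) (∨-true₁ (pineAdj₀-true adj))
pineapple-adjacent g i j ne (inj₂ adj) =
  cong₂ _∧_ (≢ᵇ-true ne) (∨-true₂ {pineAdj₀ g (toℕ i) (toℕ j)} (pineAdj₀-true adj))

pineapple-adjacent⁻ : ∀ g (i j : Fin n) → pineapple n g i j ≡ true →
  Adjacent g (toℕ i) (toℕ j) ⊎ Adjacent g (toℕ j) (toℕ i)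
pineapple-adjacent⁻ g i j h with ∨-true {pineAdj₀ g (toℕ i) (toℕ j)} (proj₂ (∧-true {not (toℕ i ≡ᵇ toℕ j)} h))
... | inj₁ q = inj₁ (pineAdj₀-true⁻ q)
... | inj₂ q = inj₂ (pineAdj₀-true⁻ q)

≡ᵇ-comm : ∀ a c → (a ≡ᵇ c) ≡ (c ≡ᵇ a)
≡ᵇ-comm zero    zero    = refl
≡ᵇ-comm zero    (suc _) = refl
≡ᵇ-comm (suc _) zero    = refl
≡ᵇ-comm (suc a) (suc c) = ≡ᵇ-comm a c

pineapple-simple : ∀ n g → Simple (pineapple n g)
pineapple-simple n g =
  (λ i j → cong₂ _∧_ (cong not (≡ᵇ-comm (toℕ i) (toℕ j)))
                     (∨-comm (pineAdj₀ g (toℕ i) (toℕ j)) (pineAdj₀ g (toℕ j) (toℕ i)))) ,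
  λ i → cong (λ t → not t ∧ (pineAdj₀ g (toℕ i) (toℕ i) ∨ pineAdj₀ g (toℕ i) (toℕ i))) (≡ᵇ-true {toℕ i} refl)

pine-total : ∀ (G : Graph n) → Simple G → ∀ {xs b D} → length xs ≡ k → length D ≡ m → 2 ≤ k → m + suc k ≡ n →
  length (edges G) ≤ n → Unique (D ++ xs ∷ʳ b) → Within G (pineEdges xs b D) →
  F G + throughCycle k ≡ (cycleTotal k + m) + 2 ^ m * throughCycle k
pine-total G simple {xs} {D = D} refl refl 2≤k eq len≤ uq within with pine-grown D uq
... | d , h = trans (cong (_+ throughCycle (length xs)) (F-grown G simple 2≤k d within eq len≤)) (total-hub d h)

tabulate-surjective : ∀ (l : List A) → length l ≡ n → ∃ λ (f : Fin n → A) → tabulate f ≡ l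
tabulate-surjective l refl = List.lookup l , tabulate-lookup l

unique-tabulate⁻ : ∀ {f : Fin n → A} → Unique (tabulate f) → Injective _≡_ _≡_ f
unique-tabulate⁻ {n = suc n} uq        {zero}  {zero}  eq = refl
unique-tabulate⁻ {n = suc n} (fr ∷ uq) {zero}  {suc j} eq = contradiction eq (All.lookup fr (∈-tabulate⁺ j))
unique-tabulate⁻ {n = suc n} (fr ∷ uq) {suc i} {zero}  eq = contradiction (sym eq) (All.lookup fr (∈-tabulate⁺ i))
unique-tabulate⁻ {n = suc n} (fr ∷ uq) {suc i} {suc j} eq = cong suc (unique-tabulate⁻ uq eq)

take-length-++ : ∀ (xs ys : List A) → take (length xs) (xs ++ ys) ≡ xs
take-length-++ []       ys = refl
take-length-++ (x ∷ xs) ys = cong (x ∷_) (take-length-++ xs ys)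

drop-length-++ : ∀ (xs ys : List A) → drop (length xs) (xs ++ ys) ≡ ys
drop-length-++ []       ys = refl
drop-length-++ (x ∷ xs) ys = drop-length-++ xs ys

-- The pineapple numbers its hub first, whereas the construction lists it last.
hub-first : ∀ (u : Fin n) xs D → u ∷ xs ++ D ↭ᵥ D ++ xs ∷ʳ u
hub-first u xs D = ↭ᵥ-trans (++ᵥ-comm (u ∷ xs) D)
  (PermSetoidProperties.++⁺ˡ (setoid _) D (PermSetoidProperties.∷↭∷ʳ (setoid _) u xs))

-- The labelled pineapple and its extremality

module Canonical (k n : ℕ) (2≤k : 2 ≤ k) (k≤n : k ≤ n) where

  -- There are `suc n` vertices and the cycle has length `suc k`: the hub is `zero`, the rim
  -- consists of the vertices numbered 1 to `k`, and the pendants have the larger numbers.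
  rim : List (Fin (suc n))
  rim = take k (tabulate suc)

  pendants : List (Fin (suc n))
  pendants = drop k (tabulate suc)

  canonicalEdges : List (Edge (suc n))
  canonicalEdges = pineEdges rim zero pendants

  private
    numberedEdges : List (ℕ × ℕ)
    numberedEdges = pineEdges (upFrom 1 k) 0 (upFrom (k + 1) (n ∸ k))

    number : map (Product.map toℕ toℕ) canonicalEdges ≡ numberedEdges
    number = begin
      map (Product.map toℕ toℕ) canonicalEdges
        ≡⟨ sym (pineEdges-map toℕ rim zero pendants) ⟩
      pineEdges (map toℕ rim) 0 (map toℕ pendants)
        ≡⟨ cong₂ (λ xs D → pineEdges xs 0 D)
             (trans (sym (take-map k (tabulate suc))) (trans (cong (take k) labels) (take-upFrom 1 k≤n)))
             (trans (sym (drop-map k (tabulate suc))) (trans (cong (drop k) labels) (drop-upFrom 1 k n))) ⟩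
      numberedEdges ∎
      where
      open ≡-Reasoning
      labels : map toℕ (tabulate {n = n} suc) ≡ upFrom 1 n
      labels = toℕ-tabulate n 1 suc (λ _ → refl)

    first-upFrom : ∀ {q} → 2 ≤ q → first (upFrom 1 q) 0 ≡ 1
    first-upFrom (s≤s _) = refl

    numbered-adjacent : ∀ {a c} → (a , c) ∈ numberedEdges → a ≢ c × (Adjacent (suc k) a c ⊎ Adjacent (suc k) c a)
    numbered-adjacent q with ∈-++⁻ (map (_, 0) (upFrom (k + 1) (n ∸ k))) q
    ... | inj₁ r with ∈-map⁻ (_, 0) r
    ...   | a , a∈ , refl = (λ { refl → contradiction k<a λ () }) , inj₂ (inj₂ (inj₂ (refl , k<a)))
      where
      k<a : suc k ≤ a
      k<a = subst (_≤ a) (+-comm k 1) (∈-upFrom⁻ (k + 1) (n ∸ k) a∈)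
    numbered-adjacent q | inj₂ (here refl) rewrite first-upFrom 2≤k =
      (λ ()) , inj₂ (inj₁ (refl , s≤s (≤-trans (s≤s z≤n) 2≤k)))
    numbered-adjacent q | inj₂ (there r) with path-upFrom⁻ 1 k r
    ... | _   , inj₁ (refl , lt) = (λ ()) , inj₁ (inj₁ (refl , lt))
    ... | 1≤a , inj₂ (refl , eq) = (λ { refl → contradiction 1≤a λ () }) , inj₂ (inj₂ (inj₁ (refl , eq)))

    adjacent-numbered : ∀ {a c} → c < suc n → Adjacent (suc k) a c → (a , c) ∈ numberedEdges ⊎ (c , a) ∈ numberedEdges
    -- The pair 0, 1 is the closing edge of the list, stored as (1, 0); all other consecutive pairs
    -- on the cycle are path edges.
    adjacent-numbered {zero} c<n (inj₁ (refl , lt)) =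
      inj₂ (∈-++⁺ʳ (map (_, 0) (upFrom (k + 1) (n ∸ k))) (here (cong (_, 0) (sym (first-upFrom 2≤k)))))
    adjacent-numbered {suc a} c<n (inj₁ (refl , lt)) =
      inj₁ (∈-++⁺ʳ (map (_, 0) (upFrom (k + 1) (n ∸ k))) (there (path-upFrom-step 1 k (s≤s z≤n) lt)))
    adjacent-numbered c<n (inj₂ (inj₁ (refl , eq))) =
      inj₂ (∈-++⁺ʳ (map (_, 0) (upFrom (k + 1) (n ∸ k))) (there (last-edge 2≤k eq)))
      where
      last-edge : ∀ {q c} → 2 ≤ q → suc c ≡ suc q → (c , 0) ∈ pathEdges (upFrom 1 q) 0
      last-edge {suc q} _ refl = path-upFrom-last 1 q
    adjacent-numbered {c = c} c<n (inj₂ (inj₂ (refl , le))) =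
      inj₂ (∈-++⁺ˡ (∈-map⁺ (_, 0) (∈-upFrom⁺ (k + 1) (n ∸ k) (subst (_≤ c) (+-comm 1 k) le)
        (subst (c <_) (sym bound) c<n))))
      where
      bound : k + 1 + (n ∸ k) ≡ suc n
      bound = trans (cong (_+ (n ∸ k)) (+-comm k 1)) (cong suc (m+[n∸m]≡n k≤n))

    unnumber : ∀ {i j} → (toℕ i , toℕ j) ∈ numberedEdges → (i , j) ∈ canonicalEdges
    unnumber q = ∈-map-injective toℕ-injective (subst (_ ∈_) (sym number) q)

  canonical-within : Within (pineapple (suc n) (suc k)) canonicalEdges
  canonical-within = All.tabulate λ {(i , j)} e∈ →
    let ne , adj = numbered-adjacent (subst (_ ∈_) number (∈-map⁺ (Product.map toℕ toℕ) e∈))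
    in pineapple-adjacent (suc k) i j ne adj

  pineapple-link : ∀ {i j} → pineapple (suc n) (suc k) i j ≡ true → Link canonicalEdges i j
  pineapple-link {i} {j} h with pineapple-adjacent⁻ (suc k) i j h
  ... | inj₁ adj = [ ∈⇒link ∘ unnumber , link-sym ∘ ∈⇒link ∘ unnumber ]′ (adjacent-numbered (toℕ<n j) adj)
  ... | inj₂ adj = [ link-sym ∘ ∈⇒link ∘ unnumber , ∈⇒link ∘ unnumber ]′ (adjacent-numbered (toℕ<n i) adj)

  private
    P : Graph (suc n)
    P = pineapple (suc n) (suc k)

    P-simple : Simple P
    P-simple = pineapple-simple (suc n) (suc k)

    size : n ∸ k + suc k ≡ suc n
    size = trans (+-suc (n ∸ k) k) (cong suc (m∸n+n≡m k≤n))

    length-rim : length rim ≡ k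
    length-rim = trans (length-take k (tabulate suc))
      (trans (cong (k ⊓_) (length-tabulate {n = n} suc)) (m≤n⇒m⊓n≡m k≤n))

    length-pendants : length pendants ≡ n ∸ k
    length-pendants = trans (length-drop k (tabulate suc)) (cong (_∸ k) (length-tabulate {n = n} suc))

    canonical-unique : Unique (pendants ++ rim ∷ʳ zero)
    canonical-unique = Unique-resp-↭ᵥ (hub-first zero rim pendants)
      (subst Unique (cong (zero ∷_) (sym (take++drop≡id k (tabulate suc)))) (allFin⁺ (suc n)))

  pineTotal : ℕ
  pineTotal = (cycleTotal k + (n ∸ k)) + 2 ^ (n ∸ k) * throughCycle k

  -- An edge-preserving injection places all the pineapple edges in `G`, and the bound on the number
  -- of edges leaves no room for others. With the identity this evaluates the pineapple, with the
  -- inverse of an isomorphism any graph isomorphic to it, so invariance of `F` comes from comparing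
  -- two computed values.
  relabelled-total : ∀ (G : Graph (suc n)) → Simple G → length (edges G) ≤ suc n →
    (f : Fin (suc n) → Fin (suc n)) → Injective _≡_ _≡_ f →
    (∀ {i j} → P i j ≡ true → G (f i) (f j) ≡ true) → F G + throughCycle k ≡ pineTotal
  relabelled-total G simple len≤ f inj embed = pine-total G simple
    (trans (length-map f rim) length-rim) (trans (length-map f pendants) length-pendants) 2≤k size len≤
    (subst Unique map-vertices (Unique-map⁺ inj canonical-unique))
    (subst (Within G) (sym (pineEdges-map f rim zero pendants))
      (All-map⁺ (All.map embed canonical-within)))
    where
    map-vertices : map f (pendants ++ rim ∷ʳ zero) ≡ map f pendants ++ map f rim ∷ʳ f zero
    map-vertices = trans (map-++ f pendants (rim ∷ʳ zero)) (cong (map f pendants ++_) (map-++ f rim (zero ∷ [])))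

  pineapple-total : F P + throughCycle k ≡ pineTotal
  pineapple-total = relabelled-total P P-simple len≤ id id id
    where
    open UniqueRearrangement (undirected (suc n))
    len≤ : length (edges P) ≤ suc n
    len≤ = begin
      length (edges P)
        ≤⟨ unique-⊆⇒length≤ (edges-unique P) (pineapple-link ∘ within-link P P-simple (edges-within P P-simple)) ⟩
      length canonicalEdges
        ≡⟨ grown-length-edges (proj₁ (pine-grown pendants canonical-unique)) ⟩
      length pendants + suc (length rim)
        ≡⟨ cong₂ (λ a c → a + suc c) length-pendants length-rim ⟩
      n ∸ k + suc k
        ≡⟨ size ⟩
      suc n ∎
      where open ≤-Reasoning

  ≅-total : ∀ (G : Graph (suc n)) → Simple G → length (edges G) ≤ suc n → G ≅ P → F G + throughCycle k ≡ pineTotal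
  ≅-total G simple len≤ (σ , iso) = relabelled-total G simple len≤ from
    (λ {i} {j} eq → trans (sym (strictlyInverseˡ i)) (trans (cong to eq) (strictlyInverseˡ j)))
    (λ {i} {j} e → trans (iso (from i) (from j)) (trans (cong₂ P (strictlyInverseˡ i) (strictlyInverseˡ j)) e))
    where open Inverse σ

  -- Listing hub, rim and pendants of `G` in this order defines a bijection `f` from the pineapple
  -- labels that carries the canonical edge list onto that of `G`, up to order and orientation.
  pine⇒≅ : ∀ (G : Graph (suc n)) → Simple G → ∀ {xs u D} → length xs ≡ k →
    allFin (suc n) ↭ᵥ D ++ xs ∷ʳ u → edges G ↭ₑ pineEdges xs u D → G ≅ P
  pine⇒≅ G simple {xs} {u} {D} len V↭ E↭ with tabulate-surjective (u ∷ xs ++ D)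
    (trans (↭ᵥ-length (↭ᵥ-trans (hub-first u xs D) (↭ᵥ-sym V↭))) (length-tabulate id))
  -- The isomorphism runs from `G` to the pineapple, so its forward map is the inverse of the
  -- listing `f`.
  ... | f , tab = mk↔ₛ′ f⁻¹ f (λ i → inj (f-f⁻¹ (f i))) f-f⁻¹ ,
      λ i j → trans (sym (cong₂ G (f-f⁻¹ i) (f-f⁻¹ j))) (⇔→≡ (mk⇔ (reflect (f⁻¹ i) (f⁻¹ j)) (embed (f⁻¹ i) (f⁻¹ j))))
    where
    vertices : allFin (suc n) ↭ᵥ tabulate f
    vertices = ↭ᵥ-trans V↭ (↭ᵥ-trans (↭ᵥ-sym (hub-first u xs D)) (↭ᵥ-reflexive (sym tab)))
    inj : Injective _≡_ _≡_ f
    inj = unique-tabulate⁻ (Unique-resp-↭ᵥ vertices (allFin⁺ (suc n)))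
    preimage : ∀ w → ∃ λ i → w ≡ f i
    preimage w = ∈-tabulate⁻ (∈-resp-↭ᵥ vertices (∈-allFin w))
    f⁻¹ : Fin (suc n) → Fin (suc n)
    f⁻¹ w = proj₁ (preimage w)
    f-f⁻¹ : ∀ w → f (f⁻¹ w) ≡ w
    f-f⁻¹ w = sym (proj₂ (preimage w))
    tail : map f (tabulate suc) ≡ xs ++ D
    tail = trans (map-tabulate suc f) (proj₂ (∷-injective tab))
    edges≡ : pineEdges xs u D ≡ map (Product.map f f) canonicalEdges
    edges≡ = begin
      pineEdges xs u D
        ≡⟨ cong₂ (λ q D → pineEdges q u D) xs≡ D≡ ⟩
      pineEdges (map f rim) u (map f pendants)
        ≡⟨ cong (λ w → pineEdges (map f rim) w (map f pendants)) (sym (proj₁ (∷-injective tab))) ⟩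
      pineEdges (map f rim) (f zero) (map f pendants)
        ≡⟨ pineEdges-map f rim zero pendants ⟩
      map (Product.map f f) canonicalEdges ∎
      where
      open ≡-Reasoning
      xs≡ : xs ≡ map f rim
      xs≡ = begin
        xs                            ≡⟨ sym (take-length-++ xs D) ⟩
        take (length xs) (xs ++ D)    ≡⟨ cong₂ take len (sym tail) ⟩
        take k (map f (tabulate suc)) ≡⟨ take-map k (tabulate suc) ⟩
        map f rim ∎
      D≡ : D ≡ map f pendants
      D≡ = begin
        D                             ≡⟨ sym (drop-length-++ xs D) ⟩
        drop (length xs) (xs ++ D)    ≡⟨ cong₂ drop len (sym tail) ⟩
        drop k (map f (tabulate suc)) ≡⟨ drop-map k (tabulate suc) ⟩
        map f pendants ∎
    relabel : edges G ↭ₑ map (Product.map f f) canonicalEdges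
    relabel = ↭ₑ-trans E↭ (↭ₑ-reflexive edges≡)
    reflect : ∀ i j → G (f i) (f j) ≡ true → P i j ≡ true
    reflect i j e = within-link P P-simple canonical-within
      ([ ∈⇒link ∘ ∈-map-injective inj , link-sym ∘ ∈⇒link ∘ ∈-map-injective inj ]′
        (link⇒∈ (∈-resp-↭ₑ relabel (edges-link G simple e))))
    embed : ∀ i j → P i j ≡ true → G (f i) (f j) ≡ true
    embed i j e = within-link G simple (edges-within G simple) (∈-resp-↭ₑ (↭ₑ-sym relabel)
      ([ ∈⇒link ∘ ∈-map⁺ (Product.map f f) , link-sym ∘ ∈⇒link ∘ ∈-map⁺ (Product.map f f) ]′
        (link⇒∈ (pineapple-link e))))

  extremal : ∀ (G : Graph (suc n)) → k < n → Simple G → Unicyclic G → HasGirth G (suc k) →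
    F G ≤ F P × ((F G ≡ F P) ⇔ (G ≅ P))
  extremal G k<n simple (conn , len) (has , _) with girth-cycle G simple has
  ... | _ , _ , _ , c , within with grow G simple conn (n ∸ k) c within size
  ...   | L , Es , d₀ , within′ = bound , mk⇔ to from
    where
    d : Grown k (n ∸ k) L Es
    d = subst (λ q → Grown k q L Es) (+-identityʳ (n ∸ k)) d₀
    F≡ : F G ≡ subgraphs [] L Es
    F≡ = F-grown G simple 2≤k d within′ size (≤-reflexive len)
    bound : F G ≤ F P
    bound = +-cancelʳ-≤ (throughCycle k) (F G) (F P)
      (subst₂ _≤_ (cong (_+ throughCycle k) (sym F≡)) (sym pineapple-total) (total-≤ d))
    hub : ∀ {q} → n ∸ k ≡ suc q → subgraphs [] L Es + throughCycle k ≡ pineTotal → ∃ (Hub d)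
    hub eq = go eq d
      where
      -- The number `n ∸ k` is generalised to a variable so that it can be matched with a successor.
      go : ∀ {q r} → r ≡ suc q → (d : Grown k r L Es) →
        subgraphs [] L Es + throughCycle k ≡ (cycleTotal k + r) + 2 ^ r * throughCycle k → ∃ (Hub d)
      go refl d = total-≡⇒hub d
    to : F G ≡ F P → G ≅ P
    -- `k<n` makes `n ∸ k` a successor: there is at least one leaf, as reading off the hub requires.
    to eq with hub (+-∸-assoc 1 k<n) (trans (cong (_+ throughCycle k) (trans (sym F≡) eq)) pineapple-total)
    ... | u , h with hub⇒pine d h
    ...   | xs , D , len-xs , L↭ , Es↭ = pine⇒≅ G simple len-xs
      (↭ᵥ-trans (spanning-vertices d size) L↭)
      (↭ₑ-trans (spanning-edges G simple 2≤k d within′ (≤-reflexive (trans len (sym size)))) Es↭)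
    from : G ≅ P → F G ≡ F P
    from iso = +-cancelʳ-≡ (throughCycle k) (F G) (F P)
      (trans (≅-total G simple (≤-reflexive len) iso) (sym pineapple-total))

-- The closed formula

triangular-C : ∀ k → triangular k ≡ suc k C 2
triangular-C zero    = refl
triangular-C (suc k) = begin
  suc k + triangular k      ≡⟨ cong₂ _+_ (sym (nC1≡n (suc k))) (triangular-C k) ⟩
  suc k C 1 + suc k C 2     ≡⟨ nCk+nC[k+1]≡[n+1]C[k+1] (suc k) 1 ⟩
  suc (suc k) C 2 ∎
  where open ≡-Reasoning

triangular-square : ∀ k → triangular k + triangular (suc k) ≡ suc k * suc k
triangular-square zero    = refl
triangular-square (suc k) = begin
  triangular (suc k) + (suc (suc k) + triangular (suc k))      ≡⟨ regroup k (triangular k) ⟩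
  triangular k + triangular (suc k) + (suc (suc k) + suc k)    ≡⟨ cong (_+ (suc (suc k) + suc k)) (triangular-square k) ⟩
  suc k * suc k + (suc (suc k) + suc k)                        ≡⟨ square k ⟩
  suc (suc k) * suc (suc k) ∎
  where
  open ≡-Reasoning
  regroup : ∀ k t → (suc k + t) + (suc (suc k) + (suc k + t)) ≡ t + (suc k + t) + (suc (suc k) + suc k)
  regroup = solve-∀
  square : ∀ k → suc k * suc k + (suc (suc k) + suc k) ≡ suc (suc k) * suc (suc k)
  square = solve-∀

cycleTotal-closed : ∀ k → cycleTotal k ≡ suc k + (suc k * suc k ∸ suc k) + 1
cycleTotal-closed k = begin
  suc (triangular k) + triangular (suc k)     ≡⟨ cong suc (triangular-square k) ⟩
  suc (suc k * suc k)                         ≡⟨ cong suc (sym (m+[n∸m]≡n (m≤m*n (suc k) (suc k)))) ⟩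
  suc (suc k + (suc k * suc k ∸ suc k))       ≡⟨ +-comm 1 _ ⟩
  suc k + (suc k * suc k ∸ suc k) + 1 ∎
  where open ≡-Reasoning

-- For g = k + 2, the two largest summands of the triangular number together with the extra one make
-- g + (g - 1) + 1 = 2g; what remains is C(g-1, 2).
throughCycle-closed : ∀ k → throughCycle (suc k) ≡ 2 * suc (suc k) + suc k C 2
throughCycle-closed k = trans (expand′ k (triangular k)) (cong (2 * suc (suc k) +_) (triangular-C k))
  where
  expand′ : ∀ k t → suc (suc (suc k) + (suc k + t)) ≡ 2 * suc (suc k) + t
  expand′ = solve-∀

closed-form : ∀ {x} k m → 2 ≤ k → x + throughCycle k ≡ (cycleTotal k + m) + 2 ^ m * throughCycle k →
  x ≡ (m + suc k) + (suc k * suc k ∸ suc k) + 1 + (2 ^ m ∸ 1) * (2 * suc k + k C 2)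
closed-form {x} (suc k) m _ eq = +-cancelʳ-≡ c _ _ (begin
  x + c
    ≡⟨ eq ⟩
  (cycleTotal (suc k) + m) + 2 ^ m * c
    -- Since 2^m is positive it equals 1 + (2^m - 1) even with truncated subtraction; the copy of
    -- `c` set free by the 1 cancels the one added on the left.
    ≡⟨ cong₂ (λ t q → (t + m) + q * c) (cycleTotal-closed (suc k)) (sym (m+[n∸m]≡n (m^n>0 2 m))) ⟩
  (suc (suc k) + s + 1 + m) + (1 + (2 ^ m ∸ 1)) * c
    ≡⟨ regroup (suc (suc k)) s m (2 ^ m ∸ 1) c ⟩
  (m + suc (suc k)) + s + 1 + (2 ^ m ∸ 1) * c + c
    ≡⟨ cong (λ t → (m + suc (suc k)) + s + 1 + (2 ^ m ∸ 1) * t + c) (throughCycle-closed k) ⟩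
  (m + suc (suc k)) + s + 1 + (2 ^ m ∸ 1) * (2 * suc (suc k) + suc k C 2) + c ∎)
  where
  open ≡-Reasoning
  c = throughCycle (suc k)
  s = suc (suc k) * suc (suc k) ∸ suc (suc k)
  regroup : ∀ g s m q c → (g + s + 1 + m) + (1 + q) * c ≡ (m + g) + s + 1 + q * c + c
  regroup = solve-∀

theorem4p3 : ∀ (n g : ℕ) → 3 ≤ g → g < n →
    (∀ (G : Graph n) → Simple G → Unicyclic G → HasGirth G g →
    F G ≤ F (pineapple n g) × ((F G ≡ F (pineapple n g)) ⇔ (G ≅ pineapple n g)))
    × F (pineapple n g) ≡ n + (g * g ∸ g) + 1 + (2 ^ (n ∸ g) ∸ 1) * (2 * g + (g ∸ 1) C 2)
theorem4p3 (suc n) (suc k) (s≤s 2≤k) (s≤s k<n) =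
  (λ G → extremal G k<n) ,
  trans (closed-form k (n ∸ k) 2≤k pineapple-total)
    (cong (λ t → t + (suc k * suc k ∸ suc k) + 1 + (2 ^ (n ∸ k) ∸ 1) * (2 * suc k + k C 2))
      (trans (+-suc (n ∸ k) k) (cong suc (m∸n+n≡m (<⇒≤ k<n)))))
  where open Canonical k n 2≤k (<⇒≤ k<n)
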